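{- Let $A \subset \mathbb{Z}_{>0}$ be a set of size $4$ with co-prime elements (i.e. the greatest common divisor of all elements of $A$ is $1$). Then at least one of the following holds: (i) $m_A > 2/3$; (ii) $A = \{u, 2u, v, 2v\}$ for some $u, v \in \mathbb{Z}_{>0}$; (iii) $A$ is one of $\{1,2,3,4\}$, $\{1,2,4,5\}$, $\{1,4,5,8\}$, $\{2,3,5,10\}$.
   Context: Let $f:\mathbb{R}\to\mathbb{R}$ be the $1$-periodic function with $f(x) = 1_{[1/3,2/3)}(x) - 1/3$ for $x \in [0,1)$. For a finite set $A \subset \mathbb{Z}_{>0}$ put $f_A(x) = \sum_{a \in A} f(ax)$ and $m_A = \max_{x \in \mathbb{R}} f_A(x)$. -}

module Defs where

open import Data.Empty using (⊥; ⊥-elim)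
open import Data.Integer as ℤ using (ℤ)
import Data.Integer.Properties as ℤₚ
open import Data.List using (List; []; _∷_)
open import Data.Nat as ℕ using (ℕ; zero; suc)
import Data.Nat.Properties as ℕₚ
open import Data.Product using (∃-syntax; Σ-syntax; _×_; _,_; map₂)
open import Data.Rational
open import Data.Rational.Literals using (fromℤ)
open import Data.Rational.Properties
open import Data.Sum using (_⊎_; inj₁; inj₂)
open import Relation.Binary using (tri<; tri≈; tri>)
open import Relation.Binary.PropositionalEquality
  using (_≡_; refl; sym; trans; cong; subst)
open import Relation.Nullary using (¬_)

-- Real numbers as two-sided Dedekind cuts: L q means q < x, U q means x < q.

record ℝ : Set₁ where
  field
    L U         : ℚ → Set
    L-inhabited : ∃[ q ] L q
    U-inhabited : ∃[ q ] U q
    L-closed    : ∀ {q r} → q < r → L r → L q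
    U-closed    : ∀ {q r} → q < r → U q → U r
    L-open      : ∀ {q} → L q → ∃[ r ] q < r × L r
    U-open      : ∀ {r} → U r → ∃[ q ] q < r × U q
    disjoint    : ∀ {q} → L q → U q → ⊥
    located     : ∀ {q r} → q < r → L q ⊎ U r

open ℝ public

fromℚ : ℚ → ℝ
fromℚ p = record
  { L           = _< p
  ; U           = p <_
  ; L-inhabited = p - 1ℚ , p-1<p
  ; U-inhabited = p + 1ℚ , p<p+1
  ; L-closed    = <-trans
  ; U-closed    = λ q<r p<q → <-trans p<q q<r
  ; L-open      = λ q<p → <-dense q<p
  ; U-open      = λ p<r → map₂ (λ (a , b) → b , a) (<-dense p<r)
  ; disjoint    = <-asym
  ; located     = loc
  }
  where
  p-1<p : p - 1ℚ < p
  p-1<p = subst (p - 1ℚ <_) (+-identityʳ p) (+-monoʳ-< p (negative⁻¹ (- 1ℚ)))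

  p<p+1 : p < p + 1ℚ
  p<p+1 = subst (_< p + 1ℚ) (+-identityʳ p) (+-monoʳ-< p (positive⁻¹ 1ℚ))

  loc : ∀ {q r} → q < r → (q < p) ⊎ (p < r)
  loc {q} q<r with <-cmp q p
  ... | tri< q<p _ _ = inj₁ q<p
  ... | tri≈ _ refl _ = inj₂ q<r
  ... | tri> _ _ p<q = inj₂ (<-trans p<q q<r)

-- If h is an increasing bijection of ℚ with inverse g, then q < h(x) iff g(q) < x.

transport : (g h : ℚ → ℚ) →
            (∀ {p q} → p < q → g p < g q) →
            (∀ {p q} → p < q → h p < h q) →
            (∀ p → g (h p) ≡ p) → (∀ p → h (g p) ≡ p) →
            ℝ → ℝ
transport g h g-mono h-mono gh hg x = record
  { L           = λ q → L x (g q)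
  ; U           = λ q → U x (g q)
  ; L-inhabited = let (q , Lq) = L-inhabited x in h q , subst (L x) (sym (gh q)) Lq
  ; U-inhabited = let (q , Uq) = U-inhabited x in h q , subst (U x) (sym (gh q)) Uq
  ; L-closed    = λ q<r → L-closed x (g-mono q<r)
  ; U-closed    = λ q<r → U-closed x (g-mono q<r)
  ; L-open      = λ {q} Lq → let (r , gq<r , Lr) = L-open x Lq in
                    h r , subst (_< h r) (hg q) (h-mono gq<r) , subst (L x) (sym (gh r)) Lr
  ; U-open      = λ {r} Ur → let (q , q<gr , Uq) = U-open x Ur in
                    h q , subst (h q <_) (hg r) (h-mono q<gr) , subst (U x) (sym (gh q)) Uq
  ; disjoint    = disjoint x
  ; located     = λ q<r → located x (g-mono q<r)
  }

infixl 6 _⊖_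
infixl 7 _·_

_⊖_ : ℝ → ℤ → ℝ
x ⊖ n = transport (_+ k) (_- k) (+-monoˡ-< k) (+-monoˡ-< (- k)) gh hg x
  where
  k = fromℤ n

  gh : ∀ p → p - k + k ≡ p
  gh p = trans (+-assoc p (- k) k) (trans (cong (λ z → p + z) (+-inverseˡ k)) (+-identityʳ p))

  hg : ∀ p → p + k - k ≡ p
  hg p = trans (+-assoc p k (- k)) (trans (cong (λ z → p + z) (+-inverseʳ k)) (+-identityʳ p))

_·_ : ℕ → ℝ → ℝ
zero  · x = fromℚ 0ℚ
suc n · x =
  transport (_* 1/ a) (_* a) (*-monoˡ-<-pos (1/ a) {{1/pos⇒pos a}}) (*-monoˡ-<-pos a) gh hg x
  where
  a = fromℤ (ℤ.+ suc n)

  gh : ∀ p → p * a * 1/ a ≡ p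
  gh p = trans (*-assoc p a (1/ a)) (trans (cong (λ z → p * z) (*-inverseʳ a)) (*-identityʳ p))

  hg : ∀ p → p * 1/ a * a ≡ p
  hg p = trans (*-assoc p (1/ a) a) (trans (cong (λ z → p * z) (*-inverseˡ a)) (*-identityʳ p))

-- q ≤ x < r, where q ≤ x means that x < q fails.

_∈[_,_⟩ : ℝ → ℚ → ℚ → Set
x ∈[ q , r ⟩ = (¬ U x q) × U x r

⅓ ⅔ : ℚ
⅓ = ℤ.+ 1 / 3
⅔ = ℤ.+ 2 / 3

-- A step function on ℝ cannot be a total Agda function, because membership in a
-- half-open interval is undecidable.  Such functions are given by their graphs:
-- F x y means that F takes the value y at x.

Graph : Set₁
Graph = ℝ → ℚ → Set

data Indicator (P : Set) : ℚ → Set where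
  inside  : P → Indicator P 1ℚ
  outside : ¬ P → Indicator P 0ℚ

-- x ⊖ n ∈ [0,1) makes n the floor of x, so this is the 1-periodic extension.

f : Graph
f x y = Σ[ n ∈ ℤ ] (x ⊖ n) ∈[ 0ℚ , 1ℚ ⟩ ×
        (∃[ χ ] Indicator ((x ⊖ n) ∈[ ⅓ , ⅔ ⟩) χ × y ≡ χ - ⅓)

-- f is single-valued, and classically it is defined at every x (f-unique, f-total).

private
  fromℤ-mono-≤ : ∀ {m n} → m ℤ.≤ n → fromℤ m ≤ fromℤ n
  fromℤ-mono-≤ {m} {n} m≤n =
    *≤* (ℤₚ.≤-trans (ℤₚ.≤-reflexive (ℤₚ.*-identityʳ m))
                   (ℤₚ.≤-trans m≤n (ℤₚ.≤-reflexive (sym (ℤₚ.*-identityʳ n)))))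

  1+fromℤ : ∀ n → 1ℚ + fromℤ n ≡ fromℤ (ℤ.suc n)
  1+fromℤ n = trans (cong (_/ 1) (cong (λ k → ℤ.1ℤ ℤ.+ k) (ℤₚ.*-identityʳ n)))
                    (↥p/↧p≡p (fromℤ (ℤ.suc n)))

  U-≤ : ∀ x {q r} → q ≤ r → U x q → U x r
  U-≤ x {q} {r} q≤r Uq with <-cmp q r
  ... | tri< q<r _ _ = U-closed x q<r Uq
  ... | tri≈ _ refl _ = Uq
  ... | tri> _ _ r<q = ⊥-elim (<-irrefl refl (<-≤-trans r<q q≤r))

  -- Rephrasing of n ≤ x < n + 1 without translations.
  Floor : ℝ → ℤ → Set
  Floor x n = (¬ U x (fromℤ n)) × U x (fromℤ (ℤ.suc n))

  floor⇒ : ∀ x {n} → Floor x n → (x ⊖ n) ∈[ 0ℚ , 1ℚ ⟩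
  floor⇒ x {n} (lo , hi) =
    (λ u → lo (subst (U x) (+-identityˡ (fromℤ n)) u)) , subst (U x) (sym (1+fromℤ n)) hi

  floor⇐ : ∀ x {n} → (x ⊖ n) ∈[ 0ℚ , 1ℚ ⟩ → Floor x n
  floor⇐ x {n} (lo , hi) =
    (λ u → lo (subst (U x) (sym (+-identityˡ (fromℤ n))) u)) , subst (U x) (1+fromℤ n) hi

  floor-≮ : ∀ x {m n} → Floor x m → Floor x n → ¬ (m ℤ.< n)
  floor-≮ x (_ , hi) (lo , _) m<n =
    lo (U-≤ x (fromℤ-mono-≤ (ℤₚ.i<j⇒suc[i]≤j m<n)) hi)

  floor-unique : ∀ x {m n} → Floor x m → Floor x n → m ≡ n
  floor-unique x {m} {n} fm fn with ℤₚ.<-cmp m n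
  ... | tri< m<n _ _ = ⊥-elim (floor-≮ x fm fn m<n)
  ... | tri≈ _ m≡n _ = m≡n
  ... | tri> _ _ n<m = ⊥-elim (floor-≮ x fn fm n<m)

  -- Classical descent: either x < k + z already, or k + z is the floor of x.
  search : ∀ x k z → ¬ U x (fromℤ z) → U x (fromℤ (ℤ.+ k ℤ.+ z)) → ¬ ¬ (∃[ n ] Floor x n)
  search x zero    z lo hi no = lo (subst (λ i → U x (fromℤ i)) (ℤₚ.+-identityˡ z) hi)
  search x (suc k) z lo hi no = no (ℤ.+ k ℤ.+ z , (λ u → search x k z lo u no)
    , subst (λ i → U x (fromℤ i)) (ℤₚ.+-assoc ℤ.1ℤ (ℤ.+ k) z) hi)

  ≤-abs : ∀ q → q ≤ fromℤ (ℤ.+ ℤ.∣ ↥ q ∣)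
  ≤-abs (mkℚ (ℤ.+ n) d c) = *≤* (ℤₚ.≤-trans (ℤₚ.≤-reflexive (ℤₚ.*-identityʳ (ℤ.+ n)))
    (subst (ℤ.+ n ℤ.≤_) (ℤₚ.pos-* n (suc d)) (ℤ.+≤+ (ℕₚ.m≤m*n n (suc d)))))
  ≤-abs (mkℚ ℤ.-[1+ n ] d c) = *≤* (ℤₚ.≤-trans (ℤₚ.≤-reflexive (ℤₚ.*-identityʳ ℤ.-[1+ n ])) ℤ.-≤+)

  abs-≤ : ∀ q → fromℤ (ℤ.- (ℤ.+ ℤ.∣ ↥ q ∣)) ≤ q
  abs-≤ q@(mkℚ (ℤ.+ zero)    _ _) = neg-antimono-≤ (≤-abs (- q))
  abs-≤ q@(mkℚ (ℤ.+ (suc _)) _ _) = neg-antimono-≤ (≤-abs (- q))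
  abs-≤ q@(mkℚ ℤ.-[1+ _ ]    _ _) = neg-antimono-≤ (≤-abs (- q))

  floor-exists : ∀ x → ¬ ¬ (∃[ n ] Floor x n)
  floor-exists x with L-inhabited x | U-inhabited x
  ... | p , Lp | q , Uq = search x (n ℕ.+ m) (ℤ.- (ℤ.+ m))
      (λ u → disjoint x Lp (U-≤ x (abs-≤ p) u))
      (subst (λ i → U x (fromℤ i)) (sym cancel) (U-≤ x (≤-abs q) Uq))
    where
    m = ℤ.∣ ↥ p ∣
    n = ℤ.∣ ↥ q ∣

    cancel : ℤ.+ (n ℕ.+ m) ℤ.+ ℤ.- (ℤ.+ m) ≡ ℤ.+ n
    cancel = trans (ℤₚ.+-assoc (ℤ.+ n) (ℤ.+ m) (ℤ.- (ℤ.+ m)))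
      (trans (cong (λ i → ℤ.+ n ℤ.+ i) (ℤₚ.+-inverseʳ (ℤ.+ m))) (ℤₚ.+-identityʳ (ℤ.+ n)))

  indicator-unique : ∀ {P a b} → Indicator P a → Indicator P b → a ≡ b
  indicator-unique (inside _)  (inside _)   = refl
  indicator-unique (inside p)  (outside ¬p) = ⊥-elim (¬p p)
  indicator-unique (outside ¬p) (inside p)  = ⊥-elim (¬p p)
  indicator-unique (outside _) (outside _)  = refl

f-unique : ∀ x {y z} → f x y → f x z → y ≡ z
f-unique x (m , xm , χ , i , refl) (n , xn , ψ , j , refl)
  with refl ← floor-unique x {m} {n} (floor⇐ x xm) (floor⇐ x xn)
  = cong (_- ⅓) (indicator-unique i j)

f-total : ∀ x → ¬ ¬ (∃[ y ] f x y)
f-total x no = floor-exists x λ (n , fl) →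
  let value = λ {χ} i → no (χ - ⅓ , n , floor⇒ x fl , χ , i , refl) in
  value (outside λ p → value (inside p))

-- fSum A is f_A; a list without repetitions represents the finite set A.

fSum : List ℕ → Graph
fSum []      x w = w ≡ 0ℚ
fSum (a ∷ A) x w = ∃[ y ] ∃[ z ] f (a · x) y × fSum A x z × w ≡ y + z

IsMaximum : Graph → ℚ → Set₁
IsMaximum F m = (∃[ x ] F x m) × (∀ x y → F x y → y ≤ m)

{-# OPTIONS --safe #-}
module Submission where

-- f_A(x) > 2/3 means that at least three of the four multiples a x lie in the middle third
-- [1/3, 2/3) mod 1, so the question is which triples a < b < c have no common x.  Assume
-- gcd(a, b, c) = 1 and take x = j/(b + c): then c x ≡ -b x, and only a x and b x matter.  Let
-- g = gcd(b, c) and n = (b + c)/g.  If g ≥ 3 and c ≠ 2b, put b x in the middle third and shift a x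
-- by a multiple of 1/g.  If g = 1, let r = a/b mod n; rounding produces t with t and r t in the
-- middle third of ℤ/n, unless r is 0, ±2 or ±1/2, that is unless b = 2a, c = 2a or c = a + b.  If
-- g = 2, the same works with r t close to 0, unless r = ±1, that is b = 2a or c = 2a.  Small b + c
-- are checked by evaluation and leave two sporadic ratios, 1:5:8 and 2:3:10.  Linear algebra then
-- finds all sets of four elements whose triples are all bad.  The maximum of f_A exists because
-- f_A(x) depends only on the residue of ⌊3Px⌋ mod 3P, where P is a common multiple of the elements
-- of A.

open import Defs
open import Data.Empty using (⊥; ⊥-elim)
open import Data.List using (List; []; _∷_; length; foldr)

-- The three values of g differ in how far a x can be moved while b x and c x stay fixed. Shifts by
-- 1/g cannot jump over a window of length 1/3 once g ≥ 3. For g = 2 a half-step only exchanges the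
-- neighbourhoods of 0 and 1/2, so a x has to come within 1/6 of a multiple of 1/2. For g = 1 there
-- is no freedom, and t and r t have to be central together. Rounding puts r t near n/2 modulo n,
-- and the choice of k in n(2k + 1)/(2ρ), with ρ = ±r of least absolute value, steers t. Steering
-- breaks down for a few ρ, where the available fractions reach at best an end of the third: these
-- are either true obstructions or get an explicit t.
--
-- The bound 20 on b + c pays for the rounding errors. Halved for g = 2 it leaves n ≥ 10, which
-- cannot be lowered there: n = 9 with ρ = 3 fails.
--
-- Passing from b x to c x ≡ -b x needs a third that is symmetric under negation. Hence b x is kept
-- strictly inside, while a x may sit on the closed left end.

module Arithmetic where

  open import Data.Integer as ℤ using (ℤ; +_; -[1+_]; 0ℤ; 1ℤ; -1ℤ)
  open import Data.Integer.DivMod using (_/ℕ_; _%ℕ_; a≡a%ℕn+[a/ℕn]*n; n%ℕd<d)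
  import Data.Integer.Properties as ℤ
  import Data.Integer.Tactic.RingSolver as ℤ-Ring
  open import Data.Nat
  open import Data.Nat.Divisibility using (divides; ∣-trans)
  open import Data.Nat.DivMod
  open import Data.Nat.GCD
  open import Data.Nat.Properties
  open import Data.Nat.Tactic.RingSolver
  open import Data.Product using (∃-syntax; _×_; _,_)
  open import Data.Sum using (_⊎_; inj₁; inj₂; reduce) renaming (map to map⊎)
  open import Relation.Binary using (tri<; tri≈; tri>)
  open import Relation.Binary.PropositionalEquality hiding ([_])
  open import Relation.Nullary.Decidable using (Dec; yes; no; _×-dec_; _⊎-dec_; _→-dec_; from-yes)

  -- Linear contradictions, division and rounding in ℕ.

  infixl 6 _⊞_
  infixl 7 _⊡_

  _⊞_ : ∀ {a b c d} → a ≤ b → c ≤ d → a + c ≤ b + d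
  _⊞_ = +-mono-≤

  _⊡_ : ∀ {a b} k → a ≤ b → k * a ≤ k * b
  k ⊡ p = *-monoʳ-≤ k p

  -- A linear contradiction: l ≤ r is a nonnegative combination of hypotheses, and l = r + e + 1 a ring
  -- identity.
  opaque
    refute : ∀ {l r} → l ≤ r → ∀ e → l ≡ suc (r + e) → ⊥
    refute {r = r} p e eq = <-irrefl refl (≤-trans (≤-trans (s≤s (m≤m+n r e)) (≤-reflexive (sym eq))) p)

  ≤-by : ∀ m n → (n < m → ⊥) → m ≤ n
  ≤-by _ _ = ≮⇒≥

  <-by : ∀ m n → (n ≤ m → ⊥) → m < n
  <-by _ _ = ≰⇒>

  opaque
    division : ∀ n d → 0 < d → ∃[ r ] ∃[ q ] n ≡ r + q * d × r < d
    division n d@(suc _) _ = n % d , n / d , m≡m%n+[m/n]*n n d , m%n<n n d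

  opaque
    step-into : ∀ d z T → 0 < d → z < T + d → ∃[ σ ] T ≤ z + d * σ × z + d * σ < T + d
    step-into d z T 0<d z<T+d with m≤n⇒∃[o]m+o≡n z<T+d
    ... | E , eq with division E d 0<d
    -- The strict inequality gives E = T + d - z - 1, so `z + d * q` is T + d - 1 - r and the
    -- remainder counts down from the top of the window.
    ... | r , q , split , r<d = q , ≮⇒≥ lo , ≰⇒> hi
      where
      lo : z + d * q < T → ⊥
      lo p = refute (p ⊞ ≤-reflexive split ⊞ ≤-reflexive (sym eq) ⊞ r<d) 0
        (solve (T ∷ z ∷ d ∷ E ∷ r ∷ q ∷ []))

      hi : T + d ≤ z + d * q → ⊥
      hi p = refute (p ⊞ ≤-reflexive (sym split) ⊞ ≤-reflexive eq ⊞ z≤n {r}) 0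
        (solve (T ∷ z ∷ d ∷ E ∷ r ∷ q ∷ []))

  opaque
    -- `t` is an integer nearest to T/(2ρ); adding ρ avoids both subtraction and halves.
    nearest : ∀ ρ T → 0 < ρ → ∃[ t ] T ≤ ρ + 2 * ρ * t × ρ + 2 * ρ * t < T + 2 * ρ
    nearest ρ T 0<ρ = step-into (2 * ρ) ρ T (*-monoʳ-< 2 0<ρ)
      (<-by ρ (T + 2 * ρ) λ p → refute (p ⊞ 0<ρ) T (solve (ρ ∷ T ∷ [])))

  -- Multipliers t in the middle third of ℤ/n for which ρ t is in the middle third, or near 0.

  Inner : ℕ → ℕ → Set
  Inner n m = n < 3 * m × 3 * m < 2 * n

  -- t is n(2k + 1)/(2ρ) rounded, so ρ t is close to n/2 mod n.
  opaque
    center : ∀ ρ n k → 0 < ρ → 3 * ρ < n →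
             ∃[ t ] ∃[ m ] ρ * t ≡ m + k * n × Inner n m
             × n * (2 * k + 1) ≤ ρ + 2 * ρ * t × ρ + 2 * ρ * t < n * (2 * k + 1) + 2 * ρ
    center ρ n k 0<ρ 3ρ<n with nearest ρ (n * (2 * k + 1)) 0<ρ
    ... | t , lo , hi with m≤n⇒∃[o]m+o≡n (≤-by (k * n) (ρ * t) λ p →
      refute (2 ⊡ p ⊞ lo ⊞ 3ρ<n) (2 + 2 * ρ) (solve (ρ ∷ n ∷ k ∷ t ∷ [])))
    ... | m , eq = t , m , trans (sym eq) (+-comm (k * n) m) , (≰⇒> l , ≰⇒> u) , lo , hi
      where
      l : 3 * m ≤ n → ⊥
      l p = refute (2 ⊡ p ⊞ 3 ⊡ lo ⊞ 6 ⊡ ≤-reflexive (sym eq) ⊞ 3ρ<n) 0 (solve (ρ ∷ n ∷ k ∷ t ∷ m ∷ []))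

      u : 2 * n ≤ 3 * m → ⊥
      u p = refute (2 ⊡ p ⊞ 3 ⊡ hi ⊞ 6 ⊡ ≤-reflexive eq ⊞ 3ρ<n) 3 (solve (ρ ∷ n ∷ k ∷ t ∷ m ∷ []))

  opaque
    halve : ∀ n → ∃[ k ] (n ≡ 2 * k ⊎ n ≡ 2 * k + 1)
    halve n with division n 2 (s≤s z≤n)
    ... | 0 , k , eq , _ = k , inj₁ (trans eq (*-comm k 2))
    ... | 1 , k , eq , _ = k , inj₂ (trans eq (solve (k ∷ [])))
    ... | suc (suc _) , _ , _ , s≤s (s≤s ())

  -- In the second case ρ t ≡ - m mod n.
  InnerPair : ℕ → ℕ → Set
  InnerPair n ρ = ∃[ t ] ∃[ m ] Inner n t × Inner n m ×
    ((∃[ k ] ρ * t ≡ m + k * n) ⊎ (∃[ k ] ∃[ i ] ρ * t + m + k * n ≡ i * n))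

  opaque
    -- With k = ⌊ρ/2⌋ the ratio t/n is about (2k + 1)/(2ρ), which is 1/2 for odd ρ and 1/2 + 1/(2ρ)
    -- for even ρ. The latter is at most 5/8 for ρ ≥ 4, but 3/4 for ρ = 2.
    low : ∀ n ρ → 4 ≤ n → 0 < ρ → 3 * ρ < n → ρ ≢ 2 → InnerPair n ρ
    low n ρ 4≤n 0<ρ 3ρ<n ρ≢2 with halve ρ
    ... | k , parity with center ρ n k 0<ρ 3ρ<n
    ... | t , m , eq , inner , lo , hi = t , m , (≰⇒> l , ≰⇒> (u parity)) , inner , inj₁ (k , eq)
      where
      ρ≤ : ρ ≡ 2 * k ⊎ ρ ≡ 2 * k + 1 → ρ ≤ 2 * k + 1
      ρ≤ (inj₁ refl) = m≤m+n (2 * k) 1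
      ρ≤ (inj₂ refl) = ≤-refl

      l : 3 * t ≤ n → ⊥
      l p = refute (2 * ρ ⊡ p ⊞ 3 ⊡ lo ⊞ 3 * n ⊡ ρ≤ parity ⊞ ρ ⊡ 4≤n ⊞ 0<ρ) 0
        (solve (n ∷ ρ ∷ k ∷ t ∷ []))

      u : ρ ≡ 2 * k ⊎ ρ ≡ 2 * k + 1 → 2 * n ≤ 3 * t → ⊥
      u (inj₂ refl) p = refute (2 * (2 * k + 1) ⊡ p ⊞ 3 ⊡ hi ⊞ (2 * k + 1) ⊡ 4≤n) (3 + 2 * k)
        (solve (n ∷ k ∷ t ∷ []))
      u (inj₁ refl) p = refute (2 * (2 * k) ⊡ p ⊞ 3 ⊡ hi ⊞ 3ρ<n ⊞ 2 * n ⊡ 2≤k) 3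
        (solve (n ∷ k ∷ t ∷ []))
        where
        2≤k : 2 ≤ k
        2≤k = ≰⇒> λ where
          z≤n       → <-irrefl refl 0<ρ
          (s≤s z≤n) → ρ≢2 refl

  -- Even multiples of ρ are small: ρ (2 i) ≡ - s i mod n.
  opaque
    high-center : ∀ n ρ s l → 2 * ρ + s ≡ n → 0 < s → 3 * s < n → s + 1 ≤ 3 * (2 * l + 1) → 3 * l + 2 ≤ s →
                  InnerPair n ρ
    high-center n ρ s l refl 0<s 3s<n s≤ ≤s with center s n l 0<s 3s<n
    ... | i , m , eq , inner , lo , hi = 2 * i , m , (≰⇒> below , ≰⇒> above) , inner , inj₂ (l , i , reflected)
      where
      below : 3 * (2 * i) ≤ n → ⊥
      below p = refute (s ⊡ p ⊞ 3 ⊡ lo ⊞ n ⊡ s≤ ⊞ 3s<n) 0 (solve (ρ ∷ s ∷ l ∷ i ∷ []))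

      above : 2 * n ≤ 3 * (2 * i) → ⊥
      above p = refute (s ⊡ p ⊞ 3 ⊡ hi ⊞ 2 * n ⊡ ≤s ⊞ 3s<n) 3 (solve (ρ ∷ s ∷ l ∷ i ∷ []))

      reflected : ρ * (2 * i) + m + l * n ≡ i * n
      reflected = begin
        ρ * (2 * i) + m + l * n   ≡⟨ +-assoc (ρ * (2 * i)) m (l * n) ⟩
        ρ * (2 * i) + (m + l * n) ≡⟨ cong (λ y → ρ * (2 * i) + y) eq ⟨
        ρ * (2 * i) + s * i       ≡⟨ solve (ρ ∷ s ∷ i ∷ []) ⟩
        i * n                     ∎
        where open ≡-Reasoning

  opaque
    -- An odd multiplier near n/2 serves ρ = n/2 and ρ = n/2 - 2: one copy of ρ lies near n/2, and
    -- the remaining 2l copies add up to 0, respectively e, modulo n.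
    odd-inner : ∀ l e → 20 ≤ e + l * 4 → e < 4 → Inner (e + l * 4) (2 * l + 1)
    odd-inner l e 20≤n e<4 = ≰⇒> below , ≰⇒> above
      where
      below : 3 * (2 * l + 1) ≤ e + l * 4 → ⊥
      below p = refute (2 ⊡ p ⊞ 20≤n ⊞ 3 ⊡ e<4) 16 (solve (l ∷ e ∷ []))

      above : 2 * (e + l * 4) ≤ 3 * (2 * l + 1) → ⊥
      above p = refute (2 ⊡ p ⊞ 20≤n) (13 + 3 * e) (solve (l ∷ e ∷ []))

  opaque
    high₀ : ∀ ρ → 20 ≤ 2 * ρ → InnerPair (2 * ρ) ρ
    high₀ ρ 20≤n with division (2 * ρ) 4 (s≤s z≤n)
    ... | e , l , eq , e<4 = 2 * l + 1 , ρ
        , subst (λ n → Inner n (2 * l + 1)) (sym eq) (odd-inner l e (subst (20 ≤_) eq 20≤n) e<4)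
        , (≰⇒> below , ≰⇒> above) , inj₁ (l , solve (ρ ∷ l ∷ []))
      where
      below : 3 * ρ ≤ 2 * ρ → ⊥
      below p = refute (2 ⊡ p ⊞ 20≤n) 19 (solve (ρ ∷ []))

      above : 2 * (2 * ρ) ≤ 3 * ρ → ⊥
      above p = refute (2 ⊡ p ⊞ 20≤n) 19 (solve (ρ ∷ []))

  opaque
    -- For s = 3 rounding would aim t exactly at n/3 or at n. Here l = ⌊n/6⌋ makes t the first even
    -- number beyond n/3, and ρ t ≡ -3(l + 1) is close to n/2.
    high₃ : ∀ ρ → 20 ≤ 2 * ρ + 3 → InnerPair (2 * ρ + 3) ρ
    high₃ ρ 20≤n with division (2 * ρ + 3) 6 (s≤s z≤n)
    ... | e , l , eq , e<6 = 2 * (l + 1) , 3 * (l + 1) , (≰⇒> t-lo , ≰⇒> t-hi) , (≰⇒> m-lo , ≰⇒> m-hi)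
        , inj₂ (0 , l + 1 , solve (ρ ∷ l ∷ []))
      where
      t-lo : 3 * (2 * (l + 1)) ≤ 2 * ρ + 3 → ⊥
      t-lo p = refute (p ⊞ ≤-reflexive eq ⊞ e<6) 0 (solve (ρ ∷ l ∷ e ∷ []))

      t-hi : 2 * (2 * ρ + 3) ≤ 3 * (2 * (l + 1)) → ⊥
      t-hi p = refute (p ⊞ ≤-reflexive (sym eq) ⊞ 20≤n) (13 + e) (solve (ρ ∷ l ∷ e ∷ []))

      m-lo : 3 * (3 * (l + 1)) ≤ 2 * ρ + 3 → ⊥
      m-lo p = refute (p ⊞ ≤-reflexive eq ⊞ e<6) (3 + 3 * l) (solve (ρ ∷ l ∷ e ∷ []))

      m-hi : 2 * (2 * ρ + 3) ≤ 3 * (3 * (l + 1)) → ⊥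
      m-hi p = refute (2 ⊡ p ⊞ 3 ⊡ ≤-reflexive (sym eq) ⊞ 20≤n) (1 + 3 * e) (solve (ρ ∷ l ∷ e ∷ []))

  opaque
    high₄ : ∀ ρ → 20 ≤ 2 * ρ + 4 → InnerPair (2 * ρ + 4) ρ
    high₄ ρ 20≤n with division (2 * ρ + 4) 4 (s≤s z≤n)
    ... | e , l , eq , e<4 with m≤n⇒∃[o]m+o≡n (≤-by ρ (4 * l) λ p →
      refute (2 ⊡ p ⊞ ≤-reflexive eq ⊞ e<4) (2 + 4 * l) (solve (ρ ∷ l ∷ e ∷ [])))
    ... | m , ρ+m = 2 * l + 1 , m
        , subst (λ n → Inner n (2 * l + 1)) (sym eq) (odd-inner l e (subst (20 ≤_) eq 20≤n) e<4)
        , (≰⇒> below , ≰⇒> above) , inj₂ (0 , l , reflected)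
      where
      below : 3 * m ≤ 2 * ρ + 4 → ⊥
      below p = refute
        (2 ⊡ p ⊞ 6 ⊡ ≤-reflexive (sym ρ+m) ⊞ 6 ⊡ ≤-reflexive eq ⊞ 6 ⊡ e<4 ⊞ 20≤n) 13
        (solve (ρ ∷ l ∷ e ∷ m ∷ []))

      above : 2 * (2 * ρ + 4) ≤ 3 * m → ⊥
      above p = refute (2 ⊡ p ⊞ 6 ⊡ ≤-reflexive ρ+m ⊞ 6 ⊡ ≤-reflexive (sym eq) ⊞ 20≤n) (7 + 6 * e)
        (solve (ρ ∷ l ∷ e ∷ m ∷ []))

      reflected : ρ * (2 * l + 1) + m + 0 * (2 * ρ + 4) ≡ l * (2 * ρ + 4)
      reflected = begin
        ρ * (2 * l + 1) + m + 0 * (2 * ρ + 4) ≡⟨ solve (ρ ∷ l ∷ m ∷ []) ⟩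
        2 * ρ * l + (ρ + m)                   ≡⟨ cong (λ y → 2 * ρ * l + y) ρ+m ⟩
        2 * ρ * l + 4 * l                     ≡⟨ solve (ρ ∷ l ∷ []) ⟩
        l * (2 * ρ + 4)                       ∎
        where open ≡-Reasoning

  opaque
    -- `high-center` yields t near n(2l + 1)/s, so it asks for an odd number strictly between s/3
    -- and 2s/3. There is none for s = 0, 1, 3, 4. For s = 2 it is 1, and for s ≥ 5 the choice l =
    -- ⌊s/4⌋ gives one near s/2.
    high : ∀ n ρ s → 2 * ρ + s ≡ n → 20 ≤ n → 3 * s < n → s ≢ 1 → InnerPair n ρ
    high n ρ 0 refl 20≤n _ _ =
      subst (λ n → InnerPair n ρ) (sym (+-identityʳ (2 * ρ))) (high₀ ρ (subst (20 ≤_) (+-identityʳ (2 * ρ)) 20≤n))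
    high n ρ 1 _ _ _ s≢1 = ⊥-elim (s≢1 refl)
    high n ρ 2 eq _ 3s<n _ = high-center n ρ 2 0 eq (s≤s z≤n) 3s<n ≤-refl ≤-refl
    high n ρ 3 refl 20≤n _ _ = high₃ ρ 20≤n
    high n ρ 4 refl 20≤n _ _ = high₄ ρ 20≤n
    high n ρ s@(suc (suc (suc (suc (suc _))))) eq _ 3s<n _ with division s 4 (s≤s z≤n)
    ... | e , l , split , e<4 = high-center n ρ s l eq (s≤s z≤n) 3s<n
        (subst (λ s → s + 1 ≤ 3 * (2 * l + 1)) (sym split) (≮⇒≥ near))
        (subst (3 * l + 2 ≤_) (sym split) (≮⇒≥ far))
      where
      5≤s : 5 ≤ e + l * 4
      5≤s = subst (5 ≤_) split (s≤s (s≤s (s≤s (s≤s (s≤s z≤n)))))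

      near : 3 * (2 * l + 1) < e + l * 4 + 1 → ⊥
      near p = refute (2 ⊡ p ⊞ 3 ⊡ e<4 ⊞ 5≤s) 1 (solve (l ∷ e ∷ []))

      far : e + l * 4 < 3 * l + 2 → ⊥
      far p = refute (4 ⊡ p ⊞ 5≤s) (3 * e) (solve (l ∷ e ∷ []))

  -- Multiplication by 2 or by ±1/2 maps the middle third of ℤ/n off itself, and 3ρ = n gives only
  -- multiples on the boundary.
  opaque
    inner-pair : ∀ n ρ → 20 ≤ n → 2 * ρ ≤ n → ρ ≢ 0 → ρ ≢ 2 → 3 * ρ ≢ n → 2 * ρ + 1 ≢ n → InnerPair n ρ
    inner-pair n ρ 20≤n 2ρ≤n ρ≢0 ρ≢2 3ρ≢n 2ρ+1≢n with <-cmp (3 * ρ) n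
    ... | tri< 3ρ<n _ _ = low n ρ (≤-trans (m≤m+n 4 16) 20≤n) (n≢0⇒n>0 ρ≢0) 3ρ<n ρ≢2
    ... | tri≈ _ 3ρ≡n _ = ⊥-elim (3ρ≢n 3ρ≡n)
    ... | tri> _ _ n<3ρ with m≤n⇒∃[o]m+o≡n 2ρ≤n
    ... | s , eq = high n ρ s eq 20≤n
        (≰⇒> (λ p → 3s≮n p)) (λ { refl → 2ρ+1≢n eq })
      where
      3s≮n : n ≤ 3 * s → ⊥
      3s≮n p = refute (p ⊞ 2 ⊡ n<3ρ ⊞ 3 ⊡ ≤-reflexive eq) 1 (solve (n ∷ s ∷ ρ ∷ []))

  -- ρ t is strictly closer than n/3 to a multiple of n.
  Near0 : ℕ → ℕ → Set
  Near0 n ρ = ∃[ t ] ∃[ k ] Inner n t × 3 * (ρ * t) < 3 * (k * n) + n × 3 * (k * n) < 3 * (ρ * t) + n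

  opaque
    -- `t` is nearest to kn/ρ, so ρ t misses k n by at most ρ/2 ≤ n/4, which is less than n/3.
    -- Whether t is central depends on k/ρ and is left to the two last hypotheses.
    near0-nearest : ∀ n ρ k → 0 < ρ → 2 * ρ ≤ n → (∀ t → 2 * n * k ≤ ρ + 2 * ρ * t → 3 * t ≤ n → ⊥) →
                    (∀ t → ρ + 2 * ρ * t < 2 * n * k + 2 * ρ → 2 * n ≤ 3 * t → ⊥) → Near0 n ρ
    near0-nearest n ρ k 0<ρ 2ρ≤n below above with nearest ρ (2 * n * k) 0<ρ
    ... | t , lo , hi = t , k , (≰⇒> (below t lo) , ≰⇒> (above t hi)) , ≰⇒> l , ≰⇒> u
      where
      l : 3 * (k * n) + n ≤ 3 * (ρ * t) → ⊥
      l p = refute (2 ⊡ p ⊞ 3 ⊡ hi ⊞ 2 ⊡ 2ρ≤n) (2 + ρ) (solve (n ∷ ρ ∷ k ∷ t ∷ []))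

      u : 3 * (ρ * t) + n ≤ 3 * (k * n) → ⊥
      u p = refute (2 ⊡ p ⊞ 3 ⊡ lo ⊞ 2 ⊡ 2ρ≤n ⊞ 0<ρ) 0 (solve (n ∷ ρ ∷ k ∷ t ∷ []))

  opaque
    -- The ratio 1/3 is the end of the middle third, so t is the first integer beyond n/3. Then 3 t
    -- exceeds n by at most 3, and 3 < n/3 needs n ≥ 10. For n = 9 both candidates 4 and 5 are off
    -- by exactly n/3.
    near0₃ : ∀ n → 10 ≤ n → Near0 n 3
    near0₃ n 10≤n with division n 3 (s≤s z≤n)
    ... | e , l , refl , e<3 = l + 1 , 1 , (≰⇒> t-lo , ≰⇒> t-hi) , ≰⇒> d-lo , ≰⇒> d-hi
      where
      t-lo : 3 * (l + 1) ≤ e + l * 3 → ⊥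
      t-lo p = refute (p ⊞ e<3) 0 (solve (e ∷ l ∷ []))

      t-hi : 2 * (e + l * 3) ≤ 3 * (l + 1) → ⊥
      t-hi p = refute (p ⊞ 10≤n) (6 + e) (solve (e ∷ l ∷ []))

      d-lo : 3 * (1 * (e + l * 3)) + (e + l * 3) ≤ 3 * (3 * (l + 1)) → ⊥
      d-lo p = refute (p ⊞ 10≤n) (3 * e) (solve (e ∷ l ∷ []))

      d-hi : 3 * (3 * (l + 1)) + (e + l * 3) ≤ 3 * (1 * (e + l * 3)) → ⊥
      d-hi p = refute (p ⊞ 10≤n ⊞ 3 ⊡ e<3) 12 (solve (e ∷ l ∷ []))

  opaque
    near0₀ : ∀ n → 10 ≤ n → Near0 n 0
    near0₀ n 10≤n with halve n
    ... | l , parity = l , 0 , (≰⇒> (below parity) , ≰⇒> (above parity)) , 0<n , 0<n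
      where
      0<n : 0 < n
      0<n = ≤-trans (s≤s z≤n) 10≤n

      below : n ≡ 2 * l ⊎ n ≡ 2 * l + 1 → 3 * l ≤ n → ⊥
      below (inj₁ refl) p = refute (2 ⊡ p ⊞ 10≤n) 9 (solve (l ∷ []))
      below (inj₂ refl) p = refute (3 ⊡ p ⊞ 10≤n) (5 + l) (solve (l ∷ []))

      above : n ≡ 2 * l ⊎ n ≡ 2 * l + 1 → 2 * n ≤ 3 * l → ⊥
      above (inj₁ refl) p = refute (2 ⊡ p ⊞ 10≤n) 9 (solve (l ∷ []))
      above (inj₂ refl) p = refute (2 ⊡ p ⊞ 10≤n) 12 (solve (l ∷ []))

  opaque
    -- With k = ⌊ρ/2⌋ the ratio k/ρ is 1/2 for even ρ > 0 and between 2/5 and 1/2 for odd ρ ≥ 5,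
    -- safely inside the middle third. For ρ = 1 a central t is itself far from 0.
    near0 : ∀ n ρ → 10 ≤ n → 2 * ρ ≤ n → ρ ≢ 1 → Near0 n ρ
    near0 n ρ 10≤n 2ρ≤n ρ≢1 with halve ρ
    ... | 0 , inj₁ refl = near0₀ n 10≤n
    ... | k@(suc _) , inj₁ refl = near0-nearest n (2 * k) k (s≤s z≤n) 2ρ≤n (below k (s≤s z≤n)) (above k)
      where
      below : ∀ k → 0 < 2 * k → ∀ t → 2 * n * k ≤ 2 * k + 2 * (2 * k) * t → 3 * t ≤ n → ⊥
      below k 0<2k t lo p = refute (2 * (2 * k) ⊡ p ⊞ 3 ⊡ lo ⊞ 2 * k ⊡ 10≤n ⊞ 0<2k) (12 * k)
        (solve (n ∷ k ∷ t ∷ []))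

      above : ∀ k t → 2 * k + 2 * (2 * k) * t < 2 * n * k + 2 * (2 * k) → 2 * n ≤ 3 * t → ⊥
      above k t hi p = refute (2 * (2 * k) ⊡ p ⊞ 3 ⊡ hi ⊞ 2 * k ⊡ 10≤n) (2 + 14 * k)
        (solve (n ∷ k ∷ t ∷ []))
    ... | 0 , inj₂ refl = ⊥-elim (ρ≢1 refl)
    ... | 1 , inj₂ refl = near0₃ n 10≤n
    ... | suc (suc k) , inj₂ refl =
        near0-nearest n (2 * (2 + k) + 1) (2 + k) (s≤s z≤n) 2ρ≤n below above
      where
      below : ∀ t → 2 * n * (2 + k) ≤ 2 * (2 + k) + 1 + 2 * (2 * (2 + k) + 1) * t → 3 * t ≤ n → ⊥
      below t lo p = refute (2 * (2 * (2 + k) + 1) ⊡ p ⊞ 3 ⊡ lo ⊞ (2 * k + 2) ⊡ 10≤n) (4 + 14 * k)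
        (solve (n ∷ k ∷ t ∷ []))

      above : ∀ t → 2 * (2 + k) + 1 + 2 * (2 * (2 + k) + 1) * t < 2 * n * (2 + k) + 2 * (2 * (2 + k) + 1) →
              2 * n ≤ 3 * t → ⊥
      above t hi p = refute (2 * (2 * (2 + k) + 1) ⊡ p ⊞ 3 ⊡ hi ⊞ (2 * k + 8) ⊡ 10≤n) (67 + 14 * k)
        (solve (n ∷ k ∷ t ∷ []))

  -- Triples x < y < z without a common point.  The first four cases say that the set is not sum-free.
  Dependent : ℕ → ℕ → ℕ → Set
  Dependent a b c = b ≡ 2 * a ⊎ c ≡ 2 * a ⊎ c ≡ 2 * b ⊎ c ≡ a + b
                    ⊎ (b ≡ 5 * a × c ≡ 8 * a) ⊎ (2 * b ≡ 3 * a × c ≡ 5 * a)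

  dependent? : ∀ a b c → Dec (Dependent a b c)
  dependent? a b c = (b ≟ 2 * a) ⊎-dec (c ≟ 2 * a) ⊎-dec (c ≟ 2 * b) ⊎-dec (c ≟ a + b)
                     ⊎-dec ((b ≟ 5 * a) ×-dec (c ≟ 8 * a)) ⊎-dec ((2 * b ≟ 3 * a) ×-dec (c ≟ 5 * a))

  -- Congruences over ℤ and the middle third modulo n.

  infix 4 _≡_[mod_]

  record _≡_[mod_] (x y : ℤ) (n : ℕ) : Set where
    constructor mod-by
    field
      quot : ℤ
      eqn  : x ≡ y ℤ.+ quot ℤ.* + n

  -- `Middle` is the half-open third that occurs in f; only the open `Interior` is stable under
  -- negation.
  Interior Middle : ℕ → ℤ → Set
  Interior n x = ∃[ m ] x ≡ + m [mod n ] × Inner n m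
  Middle n x = ∃[ m ] x ≡ + m [mod n ] × n ≤ 3 * m × 3 * m < 2 * n

  Good : ℕ → ℕ → ℕ → Set
  Good a b c = ∃[ n ] ∃[ j ] 0 < n × Middle n (j ℤ.* + a) × Middle n (j ℤ.* + b) × Middle n (j ℤ.* + c)

  opaque
    mod-trans : ∀ {x y z n} → x ≡ y [mod n ] → y ≡ z [mod n ] → x ≡ z [mod n ]
    mod-trans {z = z} {n} (mod-by k refl) (mod-by l refl) = mod-by (l ℤ.+ k) (lem z k l (+ n))
      where
      lem : ∀ z k l n → z ℤ.+ l ℤ.* n ℤ.+ k ℤ.* n ≡ z ℤ.+ (l ℤ.+ k) ℤ.* n
      lem = ℤ-Ring.solve-∀

  opaque
    mod-neg : ∀ {x y n} → x ≡ y [mod n ] → ℤ.- x ≡ ℤ.- y [mod n ]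
    mod-neg {y = y} {n} (mod-by k refl) = mod-by (ℤ.- k) (lem y k (+ n))
      where
      lem : ∀ y k n → ℤ.- (y ℤ.+ k ℤ.* n) ≡ ℤ.- y ℤ.+ ℤ.- k ℤ.* n
      lem = ℤ-Ring.solve-∀

  opaque
    mod-* : ∀ t {x y n} → x ≡ y [mod n ] → t ℤ.* x ≡ t ℤ.* y [mod n ]
    mod-* t {y = y} {n} (mod-by k refl) = mod-by (t ℤ.* k) (lem t y k (+ n))
      where
      lem : ∀ t y k n → t ℤ.* (y ℤ.+ k ℤ.* n) ≡ t ℤ.* y ℤ.+ t ℤ.* k ℤ.* n
      lem = ℤ-Ring.solve-∀

  opaque
    scale-mod : ∀ g {x y n} → x ≡ y [mod n ] → + g ℤ.* x ≡ + g ℤ.* y [mod g * n ]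
    scale-mod g {y = y} {n} (mod-by k refl) =
      mod-by k (trans (lem (+ g) y k (+ n)) (cong (λ N → + g ℤ.* y ℤ.+ k ℤ.* N) (sym (ℤ.pos-* g n))))
      where
      lem : ∀ g y k n → g ℤ.* (y ℤ.+ k ℤ.* n) ≡ g ℤ.* y ℤ.+ k ℤ.* (g ℤ.* n)
      lem = ℤ-Ring.solve-∀

  interior⇒middle : ∀ {n x} → Interior n x → Middle n x
  interior⇒middle (m , eq , lo , hi) = m , eq , <⇒≤ lo , hi

  interior-resp : ∀ {n x y} → x ≡ y [mod n ] → Interior n y → Interior n x
  interior-resp e (m , eq , inner) = m , mod-trans e eq , inner

  middle-resp : ∀ {n x y} → x ≡ y [mod n ] → Middle n y → Middle n x
  middle-resp e (m , eq , inner) = m , mod-trans e eq , inner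

  opaque
    interior-neg : ∀ {n x} → Interior n x → Interior n (ℤ.- x)
    interior-neg {n} (m , eq , lo , hi) with m≤n⇒∃[o]m+o≡n (≤-by m n λ p →
        refute (2 ⊡ p ⊞ hi ⊞ z≤n {m}) 2 (solve (n ∷ m ∷ [])))
    ... | o , refl = o , mod-trans (mod-neg eq) (mod-by -1ℤ (lem (+ m) (+ o))) , ≰⇒> lo′ , ≰⇒> hi′
      where
      lem : ∀ m o → ℤ.- m ≡ o ℤ.+ -1ℤ ℤ.* (m ℤ.+ o)
      lem = ℤ-Ring.solve-∀

      lo′ : 3 * o ≤ m + o → ⊥
      lo′ p = refute (p ⊞ hi) 0 (solve (m ∷ o ∷ []))

      hi′ : 2 * (m + o) ≤ 3 * o → ⊥
      hi′ p = refute (p ⊞ lo) 0 (solve (m ∷ o ∷ []))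

  opaque
    scale-≤ : ∀ g {n m} → n ≤ 3 * m → g * n ≤ 3 * (g * m)
    scale-≤ g {n} {m} p = subst (g * n ≤_) (lem g m) (*-monoʳ-≤ g p)
      where
      lem : ∀ g m → g * (3 * m) ≡ 3 * (g * m)
      lem = solve-∀

  opaque
    scale-<ˡ : ∀ g {n m} → 0 < g → n < 3 * m → g * n < 3 * (g * m)
    scale-<ˡ g@(suc _) {n} {m} _ p = subst (g * n <_) (lem g m) (*-monoʳ-< g p)
      where
      lem : ∀ g m → g * (3 * m) ≡ 3 * (g * m)
      lem = solve-∀

  opaque
    scale-<ʳ : ∀ g {n m} → 0 < g → 3 * m < 2 * n → 3 * (g * m) < 2 * (g * n)
    scale-<ʳ g@(suc _) {n} {m} _ p = subst₂ _<_ (lem 3 g m) (lem 2 g n) (*-monoʳ-< g p)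
      where
      lem : ∀ k g m → g * (k * m) ≡ k * (g * m)
      lem = solve-∀

  opaque
    interior-scale : ∀ g {n x} → 0 < g → Interior n x → Interior (g * n) (+ g ℤ.* x)
    interior-scale g {n} 0<g (m , eq , lo , hi) = g * m
      , subst (λ y → _ ≡ y [mod g * n ]) (sym (ℤ.pos-* g m)) (scale-mod g eq)
      , scale-<ˡ g 0<g lo , scale-<ʳ g 0<g hi

  opaque
    middle-scale : ∀ g {n x} → 0 < g → Middle n x → Middle (g * n) (+ g ℤ.* x)
    middle-scale g {n} 0<g (m , eq , lo , hi) = g * m
      , subst (λ y → _ ≡ y [mod g * n ]) (sym (ℤ.pos-* g m)) (scale-mod g eq)
      , scale-≤ g lo , scale-<ʳ g 0<g hi

  opaque
    good-scale : ∀ g {a b c} → 0 < g → Good a b c → Good (g * a) (g * b) (g * c)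
    good-scale g@(suc _) 0<g (n@(suc _) , j , 0<n , A , B , C) = g * n , j , s≤s z≤n , scale A , scale B , scale C
      where
      lem : ∀ j g a → g ℤ.* (j ℤ.* a) ≡ j ℤ.* (g ℤ.* a)
      lem = ℤ-Ring.solve-∀

      scale : ∀ {a} → Middle n (j ℤ.* + a) → Middle (g * n) (j ℤ.* + (g * a))
      scale {a} M = subst (Middle (g * n))
        (trans (lem j (+ g) (+ a)) (cong (j ℤ.*_) (sym (ℤ.pos-* g a)))) (middle-scale g 0<g M)

  opaque
    centered : ∀ n r → 0 < n → ∃[ ρ ] 2 * ρ ≤ n × (r ≡ + ρ [mod n ] ⊎ r ≡ ℤ.- (+ ρ) [mod n ])
    centered n@(suc _) r _ with r %ℕ n | a≡a%ℕn+[a/ℕn]*n r n | n%ℕd<d r n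
    ... | y | eq | y<n with 2 * y ≤? n
    ... | yes 2y≤n = y , 2y≤n , inj₁ (mod-by (r /ℕ n) eq)
    ... | no  2y≰n with m≤n⇒∃[o]m+o≡n (<⇒≤ y<n)
    ... | ρ , y+ρ = ρ , ≮⇒≥ (half n y ρ y+ρ (≰⇒> 2y≰n)) , inj₂ (mod-trans (mod-by (r /ℕ n) eq)
        (mod-by 1ℤ (trans (lem (+ y) (+ ρ)) (cong (λ N → ℤ.- (+ ρ) ℤ.+ 1ℤ ℤ.* N) (cong +_ y+ρ)))))
      where
      lem : ∀ y ρ → y ≡ ℤ.- ρ ℤ.+ 1ℤ ℤ.* (y ℤ.+ ρ)
      lem = ℤ-Ring.solve-∀

      half : ∀ n y ρ → y + ρ ≡ n → n < 2 * y → n < 2 * ρ → ⊥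
      half n y ρ refl p q = refute (p ⊞ q) 1 (solve (y ∷ ρ ∷ []))

  opaque
    multiple : ∀ {D n} → 0 < D → D < 2 * n → + D ≡ + 0 [mod n ] → D ≡ n
    multiple {n = n@(suc _)} 0<D D<2n (mod-by -[1+ k ] ())
    multiple {n = n@(suc _)} 0<D D<2n (mod-by (+ 0) refl) = ⊥-elim (<-irrefl refl 0<D)
    multiple {n = n@(suc _)} 0<D D<2n (mod-by (+ 1) eq) = trans (ℤ.+-injective eq) (+-identityʳ n)
    multiple {n = n@(suc _)} 0<D D<2n (mod-by (+ suc (suc k)) eq) =
      ⊥-elim (<⇒≱ D<2n (≤-trans (*-monoˡ-≤ n (s≤s (s≤s (z≤n {k})))) (≤-reflexive (sym (ℤ.+-injective eq)))))

  opaque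
    -- `u` is an inverse of `B` modulo `N`: expand A as A (u B - v N) and substitute for u A.
    mod-invert : ∀ {u v A B ε z N} → u ℤ.* B ≡ 1ℤ ℤ.+ v ℤ.* N → u ℤ.* A ≡ ε ℤ.+ z ℤ.* N →
             A ≡ ε ℤ.* B ℤ.+ (z ℤ.* B ℤ.- A ℤ.* v) ℤ.* N
    mod-invert {u} {v} {A} {B} {ε} {z} {N} uB uA = begin
      A                                                    ≡⟨ l₁ A v N ⟩
      A ℤ.* (1ℤ ℤ.+ v ℤ.* N) ℤ.- A ℤ.* v ℤ.* N             ≡⟨ cong (λ x → A ℤ.* x ℤ.- A ℤ.* v ℤ.* N) uB ⟨
      A ℤ.* (u ℤ.* B) ℤ.- A ℤ.* v ℤ.* N                    ≡⟨ l₂ A u B v N ⟩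
      u ℤ.* A ℤ.* B ℤ.- A ℤ.* v ℤ.* N                      ≡⟨ cong (λ x → x ℤ.* B ℤ.- A ℤ.* v ℤ.* N) uA ⟩
      (ε ℤ.+ z ℤ.* N) ℤ.* B ℤ.- A ℤ.* v ℤ.* N              ≡⟨ l₃ ε z N B A v ⟩
      ε ℤ.* B ℤ.+ (z ℤ.* B ℤ.- A ℤ.* v) ℤ.* N              ∎
      where
      open ≡-Reasoning
      l₁ : ∀ A v N → A ≡ A ℤ.* (1ℤ ℤ.+ v ℤ.* N) ℤ.- A ℤ.* v ℤ.* N
      l₁ = ℤ-Ring.solve-∀
      l₂ : ∀ A u B v N → A ℤ.* (u ℤ.* B) ℤ.- A ℤ.* v ℤ.* N ≡ u ℤ.* A ℤ.* B ℤ.- A ℤ.* v ℤ.* N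
      l₂ = ℤ-Ring.solve-∀
      l₃ : ∀ ε z N B A v → (ε ℤ.+ z ℤ.* N) ℤ.* B ℤ.- A ℤ.* v ℤ.* N ≡ ε ℤ.* B ℤ.+ (z ℤ.* B ℤ.- A ℤ.* v) ℤ.* N
      l₃ = ℤ-Ring.solve-∀

  opaque
    -- Since u inverts b, the numerator t u sends g b to g t. The extra n τ contributes a multiple
    -- of g n, so it is free to be spent on a.
    frame : ∀ t {u v b n} g τ → u ℤ.* b ≡ 1ℤ ℤ.+ v ℤ.* n →
            (t ℤ.* u ℤ.+ n ℤ.* τ) ℤ.* (g ℤ.* b) ≡ g ℤ.* t ℤ.+ (t ℤ.* v ℤ.+ τ ℤ.* b) ℤ.* (g ℤ.* n)
    frame t {u} {v} {b} {n} g τ ub = begin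
      (t ℤ.* u ℤ.+ n ℤ.* τ) ℤ.* (g ℤ.* b)                         ≡⟨ l₁ t u n τ g b ⟩
      g ℤ.* t ℤ.* (u ℤ.* b) ℤ.+ τ ℤ.* b ℤ.* (g ℤ.* n)
        ≡⟨ cong (λ x → g ℤ.* t ℤ.* x ℤ.+ τ ℤ.* b ℤ.* (g ℤ.* n)) ub ⟩
      g ℤ.* t ℤ.* (1ℤ ℤ.+ v ℤ.* n) ℤ.+ τ ℤ.* b ℤ.* (g ℤ.* n)      ≡⟨ l₂ t v n τ g b ⟩
      g ℤ.* t ℤ.+ (t ℤ.* v ℤ.+ τ ℤ.* b) ℤ.* (g ℤ.* n)             ∎
      where
      open ≡-Reasoning
      l₁ : ∀ t u n τ g b → (t ℤ.* u ℤ.+ n ℤ.* τ) ℤ.* (g ℤ.* b) ≡ g ℤ.* t ℤ.* (u ℤ.* b) ℤ.+ τ ℤ.* b ℤ.* (g ℤ.* n)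
      l₁ = ℤ-Ring.solve-∀
      l₂ : ∀ t v n τ g b → g ℤ.* t ℤ.* (1ℤ ℤ.+ v ℤ.* n) ℤ.+ τ ℤ.* b ℤ.* (g ℤ.* n)
                         ≡ g ℤ.* t ℤ.+ (t ℤ.* v ℤ.+ τ ℤ.* b) ℤ.* (g ℤ.* n)
      l₂ = ℤ-Ring.solve-∀

  -- Triples with small b + c by evaluation, and the shifted point for the others.

  MiddleResidue : (n : ℕ) → .{{NonZero n}} → ℕ → Set
  MiddleResidue n k = n ≤ 3 * (k % n) × 3 * (k % n) < 2 * n

  middleResidue? : ∀ n .{{_ : NonZero n}} k → Dec (MiddleResidue n k)
  middleResidue? n k = (n ≤? 3 * (k % n)) ×-dec (3 * (k % n) <? 2 * n)

  module _ (n : ℕ) .{{_ : NonZero n}} (a b c : ℕ) where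
    CommonMiddle : Set
    CommonMiddle = ∃[ j ] j < n × (MiddleResidue n (j * a) × MiddleResidue n (j * b) × MiddleResidue n (j * c))

    commonMiddle? : Dec CommonMiddle
    commonMiddle? = anyUpTo?
      (λ j → middleResidue? n (j * a) ×-dec middleResidue? n (j * b) ×-dec middleResidue? n (j * c)) n

  -- `c` is the predecessor of the largest element, which makes the modulus a visible successor.
  SmallCase : ℕ → ℕ → ℕ → Set
  SmallCase a b c = CommonMiddle (suc (b + c)) a b (suc c) ⊎ CommonMiddle 11 a b (suc c) ⊎ Dependent a b (suc c)

  smallCase? : ∀ a b c → Dec (SmallCase a b c)
  smallCase? a b c =
    commonMiddle? (suc (b + c)) a b (suc c) ⊎-dec commonMiddle? 11 a b (suc c) ⊎-dec dependent? a b (suc c)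

  -- The modulus 11 serves the triple 4, 6, 7 only.
  opaque
    small-cases : ∀ {c} → c < 19 → ∀ {b} → b < suc c → ∀ {a} → a < b → b + suc c < 20 → 0 < a → SmallCase a b c
    small-cases = from-yes (allUpTo? (λ c → allUpTo? (λ b → allUpTo? (λ a →
      (b + suc c <? 20) →-dec ((0 <? a) →-dec smallCase? a b c)) b) (suc c)) 19)

  -- The point is j / (g (b + c)), with j ≡ t u mod b + c; the choice of σ moves a x by multiples of 1 / g
  -- and leaves b x and c x fixed.
  opaque
    good-shift : ∀ {a b c g t u w} σ → 0 < g → 0 < b + c → u ℤ.* + b ≡ 1ℤ [mod b + c ] →
                 w ℤ.* + a ≡ 1ℤ [mod g ] → Inner (b + c) t →
                 Middle (g * (b + c)) (+ t ℤ.* (u ℤ.* + a) ℤ.+ + (b + c) ℤ.* σ) → Good a (g * b) (g * c)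
    good-shift {a} {b} {c} {g} {t} {u} {w} σ 0<g 0<n (mod-by v ub) (mod-by s wa) inner middle =
      g * n , j , *-mono-< 0<g 0<n
      , middle-resp a-shift middle
      , interior⇒middle b-interior
      , interior⇒middle (interior-resp c-reflects (interior-neg b-interior))
      where
      n : ℕ
      n = b + c

      j : ℤ
      j = + t ℤ.* u ℤ.+ + n ℤ.* (w ℤ.* σ)

      b-interior : Interior (g * n) (j ℤ.* + (g * b))
      b-interior = interior-resp
        (mod-by (+ t ℤ.* v ℤ.+ w ℤ.* σ ℤ.* + b) (begin
          j ℤ.* + (g * b)                                      ≡⟨ cong (j ℤ.*_) (ℤ.pos-* g b) ⟩
          j ℤ.* (+ g ℤ.* + b)                                  ≡⟨ frame (+ t) (+ g) (w ℤ.* σ) ub ⟩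
          + g ℤ.* + t ℤ.+ q ℤ.* (+ g ℤ.* + n)                  ≡⟨ cong (λ N → + g ℤ.* + t ℤ.+ q ℤ.* N) (ℤ.pos-* g n) ⟨
          + g ℤ.* + t ℤ.+ q ℤ.* + (g * n)                      ∎))
        (interior-scale g 0<g (t , mod-by 0ℤ (sym (ℤ.+-identityʳ (+ t))) , inner))
        where
        open ≡-Reasoning
        q : ℤ
        q = + t ℤ.* v ℤ.+ w ℤ.* σ ℤ.* + b

      c-reflects : j ℤ.* + (g * c) ≡ ℤ.- (j ℤ.* + (g * b)) [mod g * n ]
      c-reflects = mod-by j (begin
        j ℤ.* + (g * c)                                        ≡⟨ lem j (+ (g * b)) (+ (g * c)) ⟩
        ℤ.- (j ℤ.* + (g * b)) ℤ.+ j ℤ.* + (g * b + g * c)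
          ≡⟨ cong (λ N → ℤ.- (j ℤ.* + (g * b)) ℤ.+ j ℤ.* + N) (*-distribˡ-+ g b c) ⟨
        ℤ.- (j ℤ.* + (g * b)) ℤ.+ j ℤ.* + (g * n)              ∎)
        where
        open ≡-Reasoning
        lem : ∀ j b c → j ℤ.* c ≡ ℤ.- (j ℤ.* b) ℤ.+ j ℤ.* (b ℤ.+ c)
        lem = ℤ-Ring.solve-∀

      a-shift : j ℤ.* + a ≡ + t ℤ.* (u ℤ.* + a) ℤ.+ + n ℤ.* σ [mod g * n ]
      a-shift = mod-by (σ ℤ.* s) (begin
        j ℤ.* + a                                                        ≡⟨ l₁ (+ t) u (+ n) w σ (+ a) ⟩
        x ℤ.+ + n ℤ.* σ ℤ.* (w ℤ.* + a)                                  ≡⟨ cong (λ y → x ℤ.+ + n ℤ.* σ ℤ.* y) wa ⟩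
        x ℤ.+ + n ℤ.* σ ℤ.* (1ℤ ℤ.+ s ℤ.* + g)                           ≡⟨ l₂ x (+ n) σ s (+ g) ⟩
        x ℤ.+ + n ℤ.* σ ℤ.+ σ ℤ.* s ℤ.* (+ g ℤ.* + n)
          ≡⟨ cong (λ N → x ℤ.+ + n ℤ.* σ ℤ.+ σ ℤ.* s ℤ.* N) (ℤ.pos-* g n) ⟨
        x ℤ.+ + n ℤ.* σ ℤ.+ σ ℤ.* s ℤ.* + (g * n)                        ∎)
        where
        open ≡-Reasoning
        x : ℤ
        x = + t ℤ.* (u ℤ.* + a)
        l₁ : ∀ t u n w σ a → (t ℤ.* u ℤ.+ n ℤ.* (w ℤ.* σ)) ℤ.* a ≡ t ℤ.* (u ℤ.* a) ℤ.+ n ℤ.* σ ℤ.* (w ℤ.* a)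
        l₁ = ℤ-Ring.solve-∀
        l₂ : ∀ x n σ s g → x ℤ.+ n ℤ.* σ ℤ.* (1ℤ ℤ.+ s ℤ.* g) ≡ x ℤ.+ n ℤ.* σ ℤ.+ σ ℤ.* s ℤ.* (g ℤ.* n)
        l₂ = ℤ-Ring.solve-∀

  opaque
    mod-solve : ∀ {u a b ε n} → u ℤ.* + b ≡ 1ℤ [mod n ] → u ℤ.* + a ≡ ε [mod n ] → + a ≡ ε ℤ.* + b [mod n ]
    mod-solve {u} {a} {b} {ε} {n} (mod-by v ub) (mod-by z ua) =
      mod-by (z ℤ.* + b ℤ.- + a ℤ.* v) (mod-invert {u} {v} {+ a} {+ b} {ε} {z} {+ n} ub ua)

  opaque
    pair-interior : ∀ {n ρ} → InnerPair n ρ → ∃[ t ] Inner n t × Interior n (+ t ℤ.* + ρ)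
    pair-interior {n} {ρ} (t , m , inner-t , inner-m , inj₁ (k , eq)) = t , inner-t , m , mod-by (+ k) (begin
      + t ℤ.* + ρ           ≡⟨ ℤ.*-comm (+ t) (+ ρ) ⟩
      + ρ ℤ.* + t           ≡⟨ ℤ.pos-* ρ t ⟨
      + (ρ * t)             ≡⟨ cong +_ eq ⟩
      + m ℤ.+ + (k * n)     ≡⟨ cong (λ y → + m ℤ.+ y) (ℤ.pos-* k n) ⟩
      + m ℤ.+ + k ℤ.* + n   ∎) , inner-m
      where open ≡-Reasoning
    pair-interior {n} {ρ} (t , m , inner-t , inner-m , inj₂ (k , i , eq)) =
      t , inner-t , interior-resp (mod-by (+ i ℤ.- + k) (begin
        + t ℤ.* + ρ                                             ≡⟨ l₁ (+ t) (+ ρ) (+ m) (+ k ℤ.* + n) ⟩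
        ℤ.- + m ℤ.+ ((+ ρ ℤ.* + t ℤ.+ + m ℤ.+ + k ℤ.* + n) ℤ.- + k ℤ.* + n)
          ≡⟨ cong (λ x → ℤ.- + m ℤ.+ (x ℤ.- + k ℤ.* + n)) eqℤ ⟩
        ℤ.- + m ℤ.+ (+ i ℤ.* + n ℤ.- + k ℤ.* + n)               ≡⟨ l₂ (+ m) (+ i) (+ k) (+ n) ⟩
        ℤ.- + m ℤ.+ (+ i ℤ.- + k) ℤ.* + n                       ∎))
      (interior-neg (m , mod-by 0ℤ (sym (ℤ.+-identityʳ (+ m))) , inner-m))
      where
      open ≡-Reasoning
      eqℤ : + ρ ℤ.* + t ℤ.+ + m ℤ.+ + k ℤ.* + n ≡ + i ℤ.* + n
      eqℤ = begin
        + ρ ℤ.* + t ℤ.+ + m ℤ.+ + k ℤ.* + n   ≡⟨ cong₂ (λ x y → x ℤ.+ + m ℤ.+ y) (ℤ.pos-* ρ t) (ℤ.pos-* k n) ⟨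
        + (ρ * t + m + k * n)                 ≡⟨ cong +_ eq ⟩
        + (i * n)                             ≡⟨ ℤ.pos-* i n ⟩
        + i ℤ.* + n                           ∎
      l₁ : ∀ t ρ m x → t ℤ.* ρ ≡ ℤ.- m ℤ.+ ((ρ ℤ.* t ℤ.+ m ℤ.+ x) ℤ.- x)
      l₁ = ℤ-Ring.solve-∀
      l₂ : ∀ m i k n → ℤ.- m ℤ.+ (i ℤ.* n ℤ.- k ℤ.* n) ≡ ℤ.- m ℤ.+ (i ℤ.- k) ℤ.* n
      l₂ = ℤ-Ring.solve-∀

  opaque
    third : ∀ ρ x → 20 ≤ 3 * ρ → x ≤ 2 → ∃[ i ] Inner (3 * ρ) (x + 3 * i)
    third ρ x 20≤n x≤2 with step-into 3 x (1 + ρ) (s≤s z≤n) (<-by x (1 + ρ + 3) λ p →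
      refute (p ⊞ x≤2) (1 + ρ) (solve (ρ ∷ x ∷ [])))
    ... | i , lo , hi = i , (≰⇒> below , ≰⇒> above)
      where
      below : 3 * (x + 3 * i) ≤ 3 * ρ → ⊥
      below p = refute (p ⊞ 3 ⊡ lo) 2 (solve (ρ ∷ x ∷ i ∷ []))

      above : 2 * (3 * ρ) ≤ 3 * (x + 3 * i) → ⊥
      above p = refute (p ⊞ 3 ⊡ hi ⊞ 20≤n) 10 (solve (ρ ∷ x ∷ i ∷ []))

  opaque
    third-middle : ∀ ρ → 0 < ρ → ∀ {x} → x ≡ + ρ [mod 3 * ρ ] → Middle (3 * ρ) x
    third-middle ρ 0<ρ eq = ρ , eq , ≤-refl , <-by (3 * ρ) (2 * (3 * ρ)) λ p →
      refute (p ⊞ 3 ⊡ 0<ρ) 2 (solve (ρ ∷ []))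

  opaque
    -- When 3ρ = n all multiples of ρ are 0, n/3 or 2n/3, and only n/3 belongs to the half-open
    -- third. It is reached with t ≡ 1 mod 3 for r ≡ ρ and with t ≡ 2 mod 3 for r ≡ -ρ.
    middle-multiple : ∀ n ρ {r} → 20 ≤ n → 2 * ρ ≤ n → ρ ≢ 0 → ρ ≢ 2 → 2 * ρ + 1 ≢ n →
                      r ≡ + ρ [mod n ] ⊎ r ≡ ℤ.- (+ ρ) [mod n ] → ∃[ t ] Inner n t × Middle n (+ t ℤ.* r)
    middle-multiple n ρ 20≤n 2ρ≤n ρ≢0 ρ≢2 2ρ+1≢n r≡ with 3 * ρ ≟ n
    middle-multiple _ ρ 20≤n _ ρ≢0 _ _ (inj₁ r≡) | yes refl with third ρ 1 20≤n (s≤s z≤n)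
    ... | i , inner = 1 + 3 * i , inner , third-middle ρ (n≢0⇒n>0 ρ≢0) (mod-trans (mod-* (+ (1 + 3 * i)) r≡)
        (mod-by (+ i) (begin
          + (1 + 3 * i) ℤ.* + ρ                ≡⟨ cong (λ y → (1ℤ ℤ.+ y) ℤ.* + ρ) (ℤ.pos-* 3 i) ⟩
          (1ℤ ℤ.+ + 3 ℤ.* + i) ℤ.* + ρ         ≡⟨ lem (+ i) (+ ρ) ⟩
          + ρ ℤ.+ + i ℤ.* (+ 3 ℤ.* + ρ)        ≡⟨ cong (λ N → + ρ ℤ.+ + i ℤ.* N) (ℤ.pos-* 3 ρ) ⟨
          + ρ ℤ.+ + i ℤ.* + (3 * ρ)            ∎)))
      where
      open ≡-Reasoning
      lem : ∀ i ρ → (1ℤ ℤ.+ + 3 ℤ.* i) ℤ.* ρ ≡ ρ ℤ.+ i ℤ.* (+ 3 ℤ.* ρ)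
      lem = ℤ-Ring.solve-∀
    middle-multiple _ ρ 20≤n _ ρ≢0 _ _ (inj₂ r≡) | yes refl with third ρ 2 20≤n (s≤s (s≤s z≤n))
    ... | i , inner = 2 + 3 * i , inner , third-middle ρ (n≢0⇒n>0 ρ≢0) (mod-trans (mod-* (+ (2 + 3 * i)) r≡)
        (mod-by (ℤ.- (1ℤ ℤ.+ + i)) (begin
          + (2 + 3 * i) ℤ.* ℤ.- + ρ                        ≡⟨ cong (λ y → (+ 2 ℤ.+ y) ℤ.* ℤ.- + ρ) (ℤ.pos-* 3 i) ⟩
          (+ 2 ℤ.+ + 3 ℤ.* + i) ℤ.* ℤ.- + ρ                ≡⟨ lem (+ i) (+ ρ) ⟩
          + ρ ℤ.+ ℤ.- (1ℤ ℤ.+ + i) ℤ.* (+ 3 ℤ.* + ρ)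
            ≡⟨ cong (λ N → + ρ ℤ.+ ℤ.- (1ℤ ℤ.+ + i) ℤ.* N) (ℤ.pos-* 3 ρ) ⟨
          + ρ ℤ.+ ℤ.- (1ℤ ℤ.+ + i) ℤ.* + (3 * ρ)           ∎)))
      where
      open ≡-Reasoning
      lem : ∀ i ρ → (+ 2 ℤ.+ + 3 ℤ.* i) ℤ.* ℤ.- ρ ≡ ρ ℤ.+ ℤ.- (1ℤ ℤ.+ i) ℤ.* (+ 3 ℤ.* ρ)
      lem = ℤ-Ring.solve-∀
    middle-multiple n ρ 20≤n 2ρ≤n ρ≢0 ρ≢2 2ρ+1≢n r≡ | no 3ρ≢n
      with pair-interior (inner-pair n ρ 20≤n 2ρ≤n ρ≢0 ρ≢2 3ρ≢n 2ρ+1≢n)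
    ... | t , inner , interior = t , inner , interior⇒middle (signed r≡)
      where
      signed : ∀ {r} → r ≡ + ρ [mod n ] ⊎ r ≡ ℤ.- (+ ρ) [mod n ] → Interior n (+ t ℤ.* r)
      signed (inj₁ r≡) = interior-resp (mod-* (+ t) r≡) interior
      signed (inj₂ r≡) = interior-resp (mod-* (+ t) r≡)
        (subst (Interior n) (ℤ.neg-distribʳ-* (+ t) (+ ρ)) (interior-neg interior))

  -- Coprime b and c: the forbidden ratios a/b modulo b + c, and the case g = 1.

  module _ {a b c : ℕ} (0<a : 0 < a) (a<b : a < b) (b<c : b < c) where

    opaque
      -- A device shared by the next lemmas: since c ≡ -b, a forbidden ratio makes a small positive
      -- combination of a, b, c divisible by n = b + c. Its size below 2n forces it to equal n,
      -- which is a linear relation or absurd.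
      a≢0·b : + a ≡ 0ℤ ℤ.* + b [mod b + c ] → ⊥
      a≢0·b a≡ = too-big (multiple 0<a bound (mod-trans a≡ (mod-by 0ℤ refl)))
        where
        bound : a < 2 * (b + c)
        bound = <-by a (2 * (b + c)) λ p → refute (p ⊞ a<b) (b + 2 * c) (solve (a ∷ b ∷ c ∷ []))

        too-big : a ≡ b + c → ⊥
        too-big eq = refute (≤-reflexive (sym eq) ⊞ a<b) c (solve (a ∷ b ∷ c ∷ []))

      a≢2·b : + a ≡ + 2 ℤ.* + b [mod b + c ] → ⊥
      a≢2·b (mod-by k eq) = too-big (multiple (≤-trans 0<a (≤-trans (m≤m+n a c) (m≤m+n (a + c) c))) bound
        (mod-by (k ℤ.+ + 2) (trans (cong (λ A → A ℤ.+ + c ℤ.+ + c) eq) (lem (+ b) (+ c) k))))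
        where
        bound : a + c + c < 2 * (b + c)
        bound = <-by (a + c + c) (2 * (b + c)) λ p → refute (p ⊞ a<b) b (solve (a ∷ b ∷ c ∷ []))

        too-big : a + c + c ≡ b + c → ⊥
        too-big eq = refute (≤-reflexive eq ⊞ b<c ⊞ 0<a) 1 (solve (a ∷ b ∷ c ∷ []))

        lem : ∀ b c k → + 2 ℤ.* b ℤ.+ k ℤ.* (b ℤ.+ c) ℤ.+ c ℤ.+ c ≡ 0ℤ ℤ.+ (k ℤ.+ + 2) ℤ.* (b ℤ.+ c)
        lem = ℤ-Ring.solve-∀

      a≡-2·b : + a ≡ ℤ.- (+ 2) ℤ.* + b [mod b + c ] → c ≡ a + b
      a≡-2·b (mod-by k eq) = sym (+-cancelʳ-≡ b (a + b) c (trans (multiple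
        (≤-trans 0<a (≤-trans (m≤m+n a b) (m≤m+n (a + b) b))) bound
        (mod-by k (trans (cong (λ A → A ℤ.+ + b ℤ.+ + b) eq) (lem (+ b) (+ c) k)))) (+-comm b c)))
        where
        bound : a + b + b < 2 * (b + c)
        bound = <-by (a + b + b) (2 * (b + c)) λ p → refute (p ⊞ a<b ⊞ b<c) (c + 1) (solve (a ∷ b ∷ c ∷ []))

        lem : ∀ b c k → ℤ.- (+ 2) ℤ.* b ℤ.+ k ℤ.* (b ℤ.+ c) ℤ.+ b ℤ.+ b ≡ 0ℤ ℤ.+ k ℤ.* (b ℤ.+ c)
        lem = ℤ-Ring.solve-∀

      -- Here ρ ≡ -1/2 modulo n, so 2a ≡ -b and the combination is 2a + b.
      a≡half-1·b : ∀ ρ → 2 * ρ + 1 ≡ b + c → + a ≡ + ρ ℤ.* + b [mod b + c ] → c ≡ 2 * a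
      a≡half-1·b ρ 2ρ+1≡n (mod-by k eq) = trans (sym (+-cancelʳ-≡ b (a + a) c (trans (multiple
        (≤-trans 0<a (≤-trans (m≤m+n a a) (m≤m+n (a + a) b))) bound (mod-by (+ b ℤ.+ k ℤ.+ k) sum)) (+-comm b c))))
        (solve (a ∷ []))
        where
        bound : a + a + b < 2 * (b + c)
        bound = <-by (a + a + b) (2 * (b + c)) λ p → refute (p ⊞ 2 ⊡ a<b ⊞ b<c) (2 + c) (solve (a ∷ b ∷ c ∷ []))

        l₁ : ∀ r b k n → r ℤ.* b ℤ.+ k ℤ.* n ℤ.+ (r ℤ.* b ℤ.+ k ℤ.* n) ℤ.+ b ≡ (r ℤ.+ r ℤ.+ 1ℤ) ℤ.* b ℤ.+ (k ℤ.+ k) ℤ.* n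
        l₁ = ℤ-Ring.solve-∀
        l₂ : ∀ b k n → n ℤ.* b ℤ.+ (k ℤ.+ k) ℤ.* n ≡ 0ℤ ℤ.+ (b ℤ.+ k ℤ.+ k) ℤ.* n
        l₂ = ℤ-Ring.solve-∀

        n≡ : + ρ ℤ.+ + ρ ℤ.+ 1ℤ ≡ + (b + c)
        n≡ = cong +_ (trans (cong (λ y → ρ + y + 1) (sym (+-identityʳ ρ))) 2ρ+1≡n)

        sum : + (a + a + b) ≡ 0ℤ ℤ.+ (+ b ℤ.+ k ℤ.+ k) ℤ.* + (b + c)
        sum = begin
          + a ℤ.+ + a ℤ.+ + b                                          ≡⟨ cong (λ A → A ℤ.+ A ℤ.+ + b) eq ⟩
          _                                                            ≡⟨ l₁ (+ ρ) (+ b) k (+ (b + c)) ⟩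
          (+ ρ ℤ.+ + ρ ℤ.+ 1ℤ) ℤ.* + b ℤ.+ (k ℤ.+ k) ℤ.* + (b + c)
            ≡⟨ cong (λ N → N ℤ.* + b ℤ.+ (k ℤ.+ k) ℤ.* + (b + c)) n≡ ⟩
          _                                                            ≡⟨ l₂ (+ b) k (+ (b + c)) ⟩
          0ℤ ℤ.+ (+ b ℤ.+ k ℤ.+ k) ℤ.* + (b + c)                       ∎
          where open ≡-Reasoning

      -- Here -ρ ≡ 1/2 modulo n, so 2a ≡ b ≡ -c and the combination is 2a + c.
      a≡-half-1·b : ∀ ρ → 2 * ρ + 1 ≡ b + c → + a ≡ ℤ.- (+ ρ) ℤ.* + b [mod b + c ] → b ≡ 2 * a
      a≡-half-1·b ρ 2ρ+1≡n (mod-by k eq) = trans (sym (+-cancelʳ-≡ c (a + a) b (multiple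
        (≤-trans 0<a (≤-trans (m≤m+n a a) (m≤m+n (a + a) c))) bound (mod-by (1ℤ ℤ.- + b ℤ.+ k ℤ.+ k) sum))))
        (solve (a ∷ []))
        where
        bound : a + a + c < 2 * (b + c)
        bound = <-by (a + a + c) (2 * (b + c)) λ p → refute (p ⊞ 2 ⊡ a<b) (1 + c) (solve (a ∷ b ∷ c ∷ []))

        l₁ : ∀ r b c k n → ℤ.- r ℤ.* b ℤ.+ k ℤ.* n ℤ.+ (ℤ.- r ℤ.* b ℤ.+ k ℤ.* n) ℤ.+ c
                         ≡ ℤ.- (r ℤ.+ r ℤ.+ 1ℤ) ℤ.* b ℤ.+ (k ℤ.+ k) ℤ.* n ℤ.+ (b ℤ.+ c)
        l₁ = ℤ-Ring.solve-∀
        l₂ : ∀ b k n → ℤ.- n ℤ.* b ℤ.+ (k ℤ.+ k) ℤ.* n ℤ.+ n ≡ 0ℤ ℤ.+ (1ℤ ℤ.- b ℤ.+ k ℤ.+ k) ℤ.* n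
        l₂ = ℤ-Ring.solve-∀

        n≡ : + ρ ℤ.+ + ρ ℤ.+ 1ℤ ≡ + (b + c)
        n≡ = cong +_ (trans (cong (λ y → ρ + y + 1) (sym (+-identityʳ ρ))) 2ρ+1≡n)

        sum : + (a + a + c) ≡ 0ℤ ℤ.+ (1ℤ ℤ.- + b ℤ.+ k ℤ.+ k) ℤ.* + (b + c)
        sum = begin
          + a ℤ.+ + a ℤ.+ + c     ≡⟨ cong (λ A → A ℤ.+ A ℤ.+ + c) eq ⟩
          _                       ≡⟨ l₁ (+ ρ) (+ b) (+ c) k (+ (b + c)) ⟩
          ℤ.- (+ ρ ℤ.+ + ρ ℤ.+ 1ℤ) ℤ.* + b ℤ.+ (k ℤ.+ k) ℤ.* + (b + c) ℤ.+ + (b + c)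
                                  ≡⟨ cong (λ N → ℤ.- N ℤ.* + b ℤ.+ (k ℤ.+ k) ℤ.* + (b + c) ℤ.+ + (b + c)) n≡ ⟩
          _                       ≡⟨ l₂ (+ b) k (+ (b + c)) ⟩
          0ℤ ℤ.+ (1ℤ ℤ.- + b ℤ.+ k ℤ.+ k) ℤ.* + (b + c) ∎
          where open ≡-Reasoning

    opaque
      unit-pair : ∀ u → 20 ≤ b + c → u ℤ.* + b ≡ 1ℤ [mod b + c ] → Good a (1 * b) (1 * c) ⊎ Dependent a b c
      unit-pair u 20≤n ub with centered (b + c) (u ℤ.* + a) (≤-trans (s≤s z≤n) 20≤n)
      ... | ρ , 2ρ≤n , ua with ρ ≟ 0 | ρ ≟ 2 | 2 * ρ + 1 ≟ b + c
      ... | yes refl | _ | _ = ⊥-elim (a≢0·b (mod-solve {u} ub (reduce ua)))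
      ... | no _ | yes refl | _ with ua
      ...   | inj₁ ua = ⊥-elim (a≢2·b (mod-solve {u} ub ua))
      ...   | inj₂ ua = inj₂ (inj₂ (inj₂ (inj₂ (inj₁ (a≡-2·b (mod-solve {u} ub ua))))))
      unit-pair u 20≤n ub | ρ , 2ρ≤n , ua | no _ | no _ | yes 2ρ+1≡n with ua
      ...   | inj₁ ua = inj₂ (inj₂ (inj₁ (a≡half-1·b ρ 2ρ+1≡n (mod-solve {u} ub ua))))
      ...   | inj₂ ua = inj₂ (inj₁ (a≡-half-1·b ρ 2ρ+1≡n (mod-solve {u} ub ua)))
      unit-pair u 20≤n ub | ρ , 2ρ≤n , ua | no ρ≢0 | no ρ≢2 | no 2ρ+1≢n
        with middle-multiple (b + c) ρ 20≤n 2ρ≤n ρ≢0 ρ≢2 2ρ+1≢n ua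
      -- For g = 1 there is nothing to shift: σ = 0, and modulo 1 even w = 0 is an inverse of a.
      ... | t , inner , middle = inj₁ (good-shift {g = 1} {t} {u} {0ℤ} 0ℤ (s≤s z≤n) (≤-trans (s≤s z≤n) 20≤n) ub
          (mod-by -1ℤ refl) inner
        (subst₂ Middle (sym (*-identityˡ (b + c))) (lem (+ t ℤ.* (u ℤ.* + a)) (+ (b + c))) middle))
        where
        lem : ∀ x n → x ≡ x ℤ.+ n ℤ.* 0ℤ
        lem = ℤ-Ring.solve-∀

  -- Larger g: shifts by 1/2, and shifts by 1/g with g ≥ 3.

  opaque
    -- The middle third modulo 2n is centred at n with radius n/3. So t ρ - k n, which is within n/3
    -- of 0, enters it after adding n.
    near0-interior : ∀ {n ρ} → Near0 n ρ →
                     ∃[ t ] ∃[ k ] Inner n t × Interior (2 * n) (+ t ℤ.* + ρ ℤ.+ + n ℤ.* (1ℤ ℤ.- + k))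
    near0-interior {n} {ρ} (t , k , inner , lo , hi) with m≤n⇒∃[o]m+o≡n (≤-by (k * n) (ρ * t + n) λ p →
      refute (3 ⊡ p ⊞ hi) (3 + 2 * n) (solve (n ∷ ρ ∷ t ∷ k ∷ [])))
    ... | m , eq = t , k , inner , m , mod-by 0ℤ (begin
        + t ℤ.* + ρ ℤ.+ + n ℤ.* (1ℤ ℤ.- + k)                      ≡⟨ l₁ (+ t) (+ ρ) (+ n) (+ k) ⟩
        (+ ρ ℤ.* + t ℤ.+ + n) ℤ.- + k ℤ.* + n
          ≡⟨ cong₂ (λ x y → (x ℤ.+ + n) ℤ.- y) (ℤ.pos-* ρ t) (ℤ.pos-* k n) ⟨
        + (ρ * t + n) ℤ.- + (k * n)                               ≡⟨ cong (λ x → + x ℤ.- + (k * n)) eq ⟨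
        + (k * n) ℤ.+ + m ℤ.- + (k * n)                           ≡⟨ l₂ (+ (k * n)) (+ m) (+ (2 * n)) ⟩
        + m ℤ.+ 0ℤ ℤ.* + (2 * n)                                  ∎)
      , ≰⇒> below , ≰⇒> above
      where
      open ≡-Reasoning
      l₁ : ∀ t ρ n k → t ℤ.* ρ ℤ.+ n ℤ.* (1ℤ ℤ.- k) ≡ (ρ ℤ.* t ℤ.+ n) ℤ.- k ℤ.* n
      l₁ = ℤ-Ring.solve-∀
      l₂ : ∀ x m n → x ℤ.+ m ℤ.- x ≡ m ℤ.+ 0ℤ ℤ.* n
      l₂ = ℤ-Ring.solve-∀

      below : 3 * m ≤ 2 * n → ⊥
      below p = refute (p ⊞ hi ⊞ 3 ⊡ ≤-reflexive (sym eq)) 0 (solve (n ∷ ρ ∷ t ∷ k ∷ m ∷ []))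

      above : 2 * (2 * n) ≤ 3 * m → ⊥
      above p = refute (p ⊞ lo ⊞ 3 ⊡ ≤-reflexive eq) 0 (solve (n ∷ ρ ∷ t ∷ k ∷ m ∷ []))

  module _ {a b c : ℕ} (0<a : 0 < a) (a<2b : a < 2 * b) (b<c : b < c) where

    opaque
      -- Now b and c are halves of the two larger elements, hence only a < 2b. A ratio 1 makes a + c
      -- a multiple of b + c, and a ratio -1 does so for a + b.
      a≡b : + a ≡ 1ℤ ℤ.* + b [mod b + c ] → a ≡ b
      a≡b (mod-by k eq) = +-cancelʳ-≡ c a b (multiple (≤-trans 0<a (m≤m+n a c)) bound
        (mod-by (k ℤ.+ 1ℤ) (trans (cong (λ A → A ℤ.+ + c) eq) (lem (+ b) (+ c) k))))
        where
        bound : a + c < 2 * (b + c)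
        bound = <-by (a + c) (2 * (b + c)) λ p → refute (p ⊞ a<2b) c (solve (a ∷ b ∷ c ∷ []))

        lem : ∀ b c k → 1ℤ ℤ.* b ℤ.+ k ℤ.* (b ℤ.+ c) ℤ.+ c ≡ 0ℤ ℤ.+ (k ℤ.+ 1ℤ) ℤ.* (b ℤ.+ c)
        lem = ℤ-Ring.solve-∀

      a≡-b : + a ≡ -1ℤ ℤ.* + b [mod b + c ] → a ≡ c
      a≡-b (mod-by k eq) = +-cancelʳ-≡ b a c (trans (multiple (≤-trans 0<a (m≤m+n a b)) bound
        (mod-by k (trans (cong (λ A → A ℤ.+ + b) eq) (lem (+ b) (+ c) k)))) (+-comm b c))
        where
        bound : a + b < 2 * (b + c)
        bound = <-by (a + b) (2 * (b + c)) λ p → refute (p ⊞ a<2b ⊞ b<c) (1 + c) (solve (a ∷ b ∷ c ∷ []))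

        lem : ∀ b c k → -1ℤ ℤ.* b ℤ.+ k ℤ.* (b ℤ.+ c) ℤ.+ b ≡ 0ℤ ℤ.+ k ℤ.* (b ℤ.+ c)
        lem = ℤ-Ring.solve-∀

    opaque
      even-pair : ∀ u w → 10 ≤ b + c → u ℤ.* + b ≡ 1ℤ [mod b + c ] → w ℤ.* + a ≡ 1ℤ [mod 2 ] →
                  Good a (2 * b) (2 * c) ⊎ Dependent a (2 * b) (2 * c)
      even-pair u w 10≤n ub wa with centered (b + c) (u ℤ.* + a) (≤-trans (s≤s z≤n) 10≤n)
      ... | ρ , 2ρ≤n , ua with ρ ≟ 1
      ... | yes refl with ua
      ...   | inj₁ ua = inj₂ (inj₁ (cong (2 *_) (sym (a≡b (mod-solve {u} ub ua)))))
      ...   | inj₂ ua = inj₂ (inj₂ (inj₁ (cong (2 *_) (sym (a≡-b (mod-solve {u} ub ua))))))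
      even-pair u w 10≤n ub wa | ρ , 2ρ≤n , ua | no ρ≢1 with near0-interior {ρ = ρ} (near0 (b + c) ρ 10≤n 2ρ≤n ρ≢1)
      ... | t , k , inner , interior with ua
      -- The shift first cancels the quotient z of u a by n, scaled by t, and then adds the 1 - k of
      -- `near0-interior`; for the opposite sign of ρ that number is negated.
      ...   | inj₁ (mod-by z ua) = inj₁ (good-shift {g = 2} {t} {u} {w} (1ℤ ℤ.- + k ℤ.- + t ℤ.* z) (s≤s z≤n)
              (≤-trans (s≤s z≤n) 10≤n) ub wa inner (interior⇒middle (subst (Interior (2 * (b + c)))
                (sym (trans (cong (λ r → + t ℤ.* r ℤ.+ + (b + c) ℤ.* (1ℤ ℤ.- + k ℤ.- + t ℤ.* z)) ua)
                  (lem (+ t) (+ ρ) (+ (b + c)) (+ k) z))) interior)))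
              where
              lem : ∀ t ρ n k z → t ℤ.* (ρ ℤ.+ z ℤ.* n) ℤ.+ n ℤ.* (1ℤ ℤ.- k ℤ.- t ℤ.* z) ≡ t ℤ.* ρ ℤ.+ n ℤ.* (1ℤ ℤ.- k)
              lem = ℤ-Ring.solve-∀
      ...   | inj₂ (mod-by z ua) = inj₁ (good-shift {g = 2} {t} {u} {w} (+ k ℤ.- 1ℤ ℤ.- + t ℤ.* z) (s≤s z≤n)
              (≤-trans (s≤s z≤n) 10≤n) ub wa inner (interior⇒middle (subst (Interior (2 * (b + c)))
                (sym (trans (cong (λ r → + t ℤ.* r ℤ.+ + (b + c) ℤ.* (+ k ℤ.- 1ℤ ℤ.- + t ℤ.* z)) ua)
                  (lem (+ t) (+ ρ) (+ (b + c)) (+ k) z))) (interior-neg interior))))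
              where
              lem : ∀ t ρ n k z → t ℤ.* (ℤ.- ρ ℤ.+ z ℤ.* n) ℤ.+ n ℤ.* (k ℤ.- 1ℤ ℤ.- t ℤ.* z)
                                  ≡ ℤ.- (t ℤ.* ρ ℤ.+ n ℤ.* (1ℤ ℤ.- k))
              lem = ℤ-Ring.solve-∀

  opaque
    half-inner : ∀ n → 4 ≤ n → ∃[ t ] Inner n t
    half-inner n 4≤n with halve n
    ... | l , inj₁ refl = l , (≰⇒> below , ≰⇒> above)
      where
      below : 3 * l ≤ 2 * l → ⊥
      below p = refute (2 ⊡ p ⊞ 4≤n) 3 (solve (l ∷ []))

      above : 2 * (2 * l) ≤ 3 * l → ⊥
      above p = refute (2 ⊡ p ⊞ 4≤n) 3 (solve (l ∷ []))
    ... | l , inj₂ refl = l , (≰⇒> below , ≰⇒> above)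
      where
      below : 3 * l ≤ 2 * l + 1 → ⊥
      below p = refute (2 ⊡ p ⊞ 4≤n) 0 (solve (l ∷ []))

      above : 2 * (2 * l + 1) ≤ 3 * l → ⊥
      above p = refute (2 ⊡ p ⊞ 4≤n) 6 (solve (l ∷ []))

  opaque
    -- Steps of length n cannot miss the middle third of ℤ/(g n), whose length g n/3 is at least n.
    shift-middle : ∀ {n} g x → 0 < n → 3 ≤ g → ∃[ σ ] Middle (g * n) (x ℤ.+ + n ℤ.* σ)
    shift-middle {n@(suc _)} g x 0<n 3≤g with x %ℕ n | a≡a%ℕn+[a/ℕn]*n x n | n%ℕd<d x n
    ... | y | x≡ | y<n
      with step-into (3 * n) (3 * y) (g * n) (s≤s z≤n) (≤-trans (*-monoʳ-< 3 y<n) (m≤n+m (3 * n) (g * n)))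
    ... | σ , lo , hi = + σ ℤ.- x /ℕ n , y + n * σ , mod-by 0ℤ (begin
        x ℤ.+ + n ℤ.* (+ σ ℤ.- x /ℕ n)
          ≡⟨ cong (λ x′ → x′ ℤ.+ + n ℤ.* (+ σ ℤ.- x /ℕ n)) x≡ ⟩
        + y ℤ.+ x /ℕ n ℤ.* + n ℤ.+ + n ℤ.* (+ σ ℤ.- x /ℕ n)            ≡⟨ lem (+ y) (x /ℕ n) (+ n) (+ σ) (+ (g * n)) ⟩
        + y ℤ.+ + n ℤ.* + σ ℤ.+ 0ℤ ℤ.* + (g * n)
          ≡⟨ cong (λ s → + y ℤ.+ s ℤ.+ 0ℤ ℤ.* + (g * n)) (ℤ.pos-* n σ) ⟨
        + (y + n * σ) ℤ.+ 0ℤ ℤ.* + (g * n)                             ∎)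
        , subst (g * n ≤_) (expand n y σ) lo , upper g n y σ 3≤g hi
      where
      open ≡-Reasoning
      lem : ∀ y q n σ N → y ℤ.+ q ℤ.* n ℤ.+ n ℤ.* (σ ℤ.- q) ≡ y ℤ.+ n ℤ.* σ ℤ.+ 0ℤ ℤ.* N
      lem = ℤ-Ring.solve-∀

      expand : ∀ n y σ → 3 * y + 3 * n * σ ≡ 3 * (y + n * σ)
      expand = solve-∀

      upper : ∀ g n y σ → 3 ≤ g → 3 * y + 3 * n * σ < g * n + 3 * n → 3 * (y + n * σ) < 2 * (g * n)
      upper g n y σ 3≤g hi = <-by (3 * (y + n * σ)) (2 * (g * n)) λ p →
        refute (p ⊞ hi ⊞ n ⊡ 3≤g) 0 (solve (g ∷ n ∷ y ∷ σ ∷ []))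

  dependent-scale : ∀ g {a b c} → Dependent a b c → Dependent (g * a) (g * b) (g * c)
  dependent-scale g {a} {b} {c} = map⊎ (scale 2 b a) (map⊎ (scale 2 c a) (map⊎ (scale 2 c b)
    (map⊎ (λ { refl → *-distribˡ-+ g a b }) (map⊎
      (λ (p , q) → scale 5 b a p , scale 8 c a q)
      (λ (p , q) → trans (exch 2 b) (trans (cong (g *_) p) (sym (exch 3 a))) , scale 5 c a q)))))
    where
    exch : ∀ k x → k * (g * x) ≡ g * (k * x)
    exch k x = lem k g x
      where
      lem : ∀ k g x → k * (g * x) ≡ g * (k * x)
      lem = solve-∀

    scale : ∀ k x y → x ≡ k * y → g * x ≡ k * (g * y)
    scale k x y refl = sym (exch k y)

  opaque
    residue⇒middle : ∀ n .{{_ : NonZero n}} j a → MiddleResidue n (j * a) → Middle n (+ j ℤ.* + a)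
    residue⇒middle n j a (lo , hi) = (j * a) % n , mod-by (+ (j * a / n)) (begin
      + j ℤ.* + a                                     ≡⟨ ℤ.pos-* j a ⟨
      + (j * a)                                       ≡⟨ cong +_ (m≡m%n+[m/n]*n (j * a) n) ⟩
      + ((j * a) % n) ℤ.+ + (j * a / n * n)           ≡⟨ cong (λ x → + ((j * a) % n) ℤ.+ x) (ℤ.pos-* (j * a / n) n) ⟩
      + ((j * a) % n) ℤ.+ + (j * a / n) ℤ.* + n       ∎) , lo , hi
      where open ≡-Reasoning

    commonMiddle⇒good : ∀ n .{{_ : NonZero n}} {a b c} → 0 < n → CommonMiddle n a b c → Good a b c
    commonMiddle⇒good n 0<n (j , _ , A , B , C) =
      n , + j , 0<n , residue⇒middle n j _ A , residue⇒middle n j _ B , residue⇒middle n j _ C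

    small-triple : ∀ {a b c} → 0 < a → a < b → b < c → b + c < 20 → Good a b c ⊎ Dependent a b c
    small-triple {b = b} {c = suc c} 0<a a<b b<c n<20
      with small-cases {c} (≤-trans (s≤s (m≤n+m c b)) (≤-pred (subst (_< 20) (+-suc b c) n<20))) b<c a<b n<20 0<a
    ... | inj₁ s = inj₁ (commonMiddle⇒good (suc (b + c)) (s≤s z≤n) s)
    ... | inj₂ (inj₁ s) = inj₁ (commonMiddle⇒good 11 (s≤s z≤n) s)
    ... | inj₂ (inj₂ d) = inj₂ d

  -- Bézout inverses and the assembly of all triples.

  opaque
    bézout : ∀ m n → ∃[ x ] ∃[ y ] x ℤ.* + m ℤ.+ y ℤ.* + n ≡ + gcd m n
    bézout m n with Bézout.identity (gcd-GCD m n)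
    ... | Bézout.+- x y eq = + x , ℤ.- + y , solve-for (+ gcd m n) (+ y ℤ.* + n) (+ x ℤ.* + m) (+ y) (+ n) refl (begin
        + gcd m n ℤ.+ + y ℤ.* + n     ≡⟨ cong (λ z → + gcd m n ℤ.+ z) (ℤ.pos-* y n) ⟨
        + (gcd m n + y * n)           ≡⟨ cong +_ eq ⟩
        + (x * m)                     ≡⟨ ℤ.pos-* x m ⟩
        + x ℤ.* + m                   ∎)
      where
      open ≡-Reasoning
      solve-for : ∀ d yn xm y n → y ℤ.* n ≡ yn → d ℤ.+ yn ≡ xm → xm ℤ.+ ℤ.- y ℤ.* n ≡ d
      solve-for d _ _ y n refl refl = lem d y n
        where
        lem : ∀ d y n → d ℤ.+ y ℤ.* n ℤ.+ ℤ.- y ℤ.* n ≡ d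
        lem = ℤ-Ring.solve-∀
    ... | Bézout.-+ x y eq = ℤ.- + x , + y , solve-for (+ gcd m n) (+ x ℤ.* + m) (+ y ℤ.* + n) (+ x) (+ m) refl (begin
        + gcd m n ℤ.+ + x ℤ.* + m     ≡⟨ cong (λ z → + gcd m n ℤ.+ z) (ℤ.pos-* x m) ⟨
        + (gcd m n + x * m)           ≡⟨ cong +_ eq ⟩
        + (y * n)                     ≡⟨ ℤ.pos-* y n ⟩
        + y ℤ.* + n                   ∎)
      where
      open ≡-Reasoning
      solve-for : ∀ d xm yn x m → x ℤ.* m ≡ xm → d ℤ.+ xm ≡ yn → ℤ.- x ℤ.* m ℤ.+ yn ≡ d
      solve-for d _ _ x m refl refl = lem d x m
        where
        lem : ∀ d x m → ℤ.- x ℤ.* m ℤ.+ (d ℤ.+ x ℤ.* m) ≡ d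
        lem = ℤ-Ring.solve-∀

  opaque
    -- Dividing Bézout's identity by g gives x b + y c = 1, and c ≡ -b turns this into (x - y) b ≡
    -- 1.
    gcd-cofactor-unit : ∀ b c g → 0 < g → gcd (g * b) (g * c) ≡ g → ∃[ u ] u ℤ.* + b ≡ 1ℤ [mod b + c ]
    gcd-cofactor-unit b c g@(suc _) _ gcd≡g with bézout (g * b) (g * c)
    ... | x , y , eq = x ℤ.- y , mod-by (ℤ.- y) (begin
        (x ℤ.- y) ℤ.* + b                                      ≡⟨ l₂ x y (+ b) (+ c) ⟩
        (x ℤ.* + b ℤ.+ y ℤ.* + c) ℤ.+ ℤ.- y ℤ.* + (b + c)      ≡⟨ cong (λ z → z ℤ.+ ℤ.- y ℤ.* + (b + c)) unit ⟩
        1ℤ ℤ.+ ℤ.- y ℤ.* + (b + c)                             ∎)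
      where
      open ≡-Reasoning
      l₁ : ∀ x y b c g → (x ℤ.* b ℤ.+ y ℤ.* c) ℤ.* g ≡ x ℤ.* (g ℤ.* b) ℤ.+ y ℤ.* (g ℤ.* c)
      l₁ = ℤ-Ring.solve-∀
      l₂ : ∀ x y b c → (x ℤ.- y) ℤ.* b ≡ (x ℤ.* b ℤ.+ y ℤ.* c) ℤ.+ ℤ.- y ℤ.* (b ℤ.+ c)
      l₂ = ℤ-Ring.solve-∀

      unit : x ℤ.* + b ℤ.+ y ℤ.* + c ≡ 1ℤ
      unit = ℤ.*-cancelʳ-≡ _ _ (+ g) (begin
        (x ℤ.* + b ℤ.+ y ℤ.* + c) ℤ.* + g                ≡⟨ l₁ x y (+ b) (+ c) (+ g) ⟩
        x ℤ.* (+ g ℤ.* + b) ℤ.+ y ℤ.* (+ g ℤ.* + c)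
          ≡⟨ cong₂ (λ B C → x ℤ.* B ℤ.+ y ℤ.* C) (ℤ.pos-* g b) (ℤ.pos-* g c) ⟨
        x ℤ.* + (g * b) ℤ.+ y ℤ.* + (g * c)              ≡⟨ eq ⟩
        + gcd (g * b) (g * c)                            ≡⟨ cong +_ gcd≡g ⟩
        + g                                              ≡⟨ ℤ.*-identityˡ (+ g) ⟨
        1ℤ ℤ.* + g                                       ∎)

  opaque
    -- An inverse of a modulo g is what lets shifts of x by multiples of 1/g move a x by any
    -- prescribed multiple of 1/g.
    coprime-unit : ∀ a g → gcd a g ≡ 1 → ∃[ w ] w ℤ.* + a ≡ 1ℤ [mod g ]
    coprime-unit a g gcd≡1 with bézout a g
    ... | x , y , eq = x , mod-by (ℤ.- y) (trans (lem (x ℤ.* + a) y (+ g))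
        (cong (λ z → z ℤ.+ ℤ.- y ℤ.* + g) (trans eq (cong +_ gcd≡1))))
      where
      lem : ∀ z y g → z ≡ (z ℤ.+ y ℤ.* g) ℤ.+ ℤ.- y ℤ.* g
      lem = ℤ-Ring.solve-∀

  sum-positive : ∀ {b c} → b < c → 0 < b + c
  sum-positive {b} {c} b<c = ≤-trans (s≤s z≤n) (≤-trans b<c (m≤n+m c b))

  opaque
    factored-triple : ∀ {a b c} g → 0 < a → a < g * b → b < c → gcd (g * b) (g * c) ≡ g → gcd a g ≡ 1 →
                      Good a (g * b) (g * c) ⊎ Dependent a (g * b) (g * c)
    factored-triple {a} {b} {c} g 0<a a<gb b<c gcd≡g cop with g * b + g * c <? 20
    factored-triple {a} {b} {c} 0 0<a () b<c gcd≡g cop | _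
    factored-triple {a} {b} {c} g@(suc _) 0<a a<gb b<c gcd≡g cop | yes n<20 =
      small-triple 0<a a<gb (*-monoʳ-< g b<c) n<20
    factored-triple {a} {b} {c} 1 0<a a<gb b<c gcd≡g cop | no n≮20
      with gcd-cofactor-unit b c 1 (s≤s z≤n) gcd≡g
    ... | u , ub with unit-pair 0<a (subst (a <_) (*-identityˡ b) a<gb) b<c u
                        (subst (20 ≤_) (cong₂ _+_ (*-identityˡ b) (*-identityˡ c)) (≮⇒≥ n≮20)) ub
    ...   | inj₁ good = inj₁ good
    ...   | inj₂ dep  = inj₂ (subst₂ (Dependent a) (sym (*-identityˡ b)) (sym (*-identityˡ c)) dep)
    factored-triple {a} {b} {c} 2 0<a a<gb b<c gcd≡g cop | no n≮20
      with gcd-cofactor-unit b c 2 (s≤s z≤n) gcd≡g | coprime-unit a 2 cop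
    ... | u , ub | w , wa = even-pair 0<a a<gb b<c u w
      (*-cancelˡ-≤ 2 (subst (20 ≤_) (sym (*-distribˡ-+ 2 b c)) (≮⇒≥ n≮20))) ub wa
    -- For 0 < b < c the sum b + c is below 4 only at b = 1, c = 2. No residue modulo 3 lies
    -- strictly inside the middle third, and c = 2b is dependent anyway.
    factored-triple {a} {b} {c} g@(suc (suc (suc _))) 0<a a<gb b<c gcd≡g cop | no n≮20 with c ≟ 2 * b
    ... | yes c≡2b = inj₂ (inj₂ (inj₂ (inj₁ (trans (cong (g *_) c≡2b) (lem g b)))))
      where
      lem : ∀ g b → g * (2 * b) ≡ 2 * (g * b)
      lem = solve-∀
    ... | no c≢2b
      with gcd-cofactor-unit b c g (s≤s z≤n) gcd≡g | coprime-unit a g cop | half-inner (b + c) (4≤b+c b c 0<b b<c c≢2b)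
      where
      0<b : 0 < b
      0<b = n≢0⇒n>0 λ { refl → <⇒≱ a<gb (subst (_≤ a) (sym (*-zeroʳ g)) z≤n) }

      4≤b+c : ∀ b c → 0 < b → b < c → c ≢ 2 * b → 4 ≤ b + c
      4≤b+c (suc zero) (suc (suc zero)) _ _ c≢2b = ⊥-elim (c≢2b refl)
      4≤b+c (suc zero) (suc (suc (suc c))) _ _ _ = s≤s (s≤s (s≤s (s≤s z≤n)))
      4≤b+c (suc zero) (suc zero) _ (s≤s ()) _
      4≤b+c (suc (suc b)) (suc (suc (suc c))) _ _ _ = +-mono-≤ {2} {suc (suc b)} {2} (s≤s (s≤s z≤n)) (s≤s (s≤s z≤n))
      4≤b+c (suc (suc b)) (suc (suc zero)) _ (s≤s (s≤s ())) _
      4≤b+c (suc (suc b)) (suc zero) _ (s≤s ()) _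
    ... | u , ub | w , wa | t , inner
      with shift-middle g (+ t ℤ.* (u ℤ.* + a)) (sum-positive b<c) (s≤s (s≤s (s≤s z≤n)))
    ... | σ , middle = inj₁ (good-shift {g = g} {t} {u} {w} σ (s≤s z≤n) (sum-positive b<c) ub wa inner middle)

  opaque
    coprime-triple : ∀ {a b c} → 0 < a → a < b → b < c → gcd a (gcd b c) ≡ 1 → Good a b c ⊎ Dependent a b c
    coprime-triple {a} {b} {c} 0<a a<b b<c cop with gcd b c in eq | gcd[m,n]∣m b c | gcd[m,n]∣n b c
    ... | g | divides b′ refl | divides c′ refl rewrite *-comm b′ g | *-comm c′ g =
      factored-triple g 0<a a<b (*-cancelˡ-< g b′ c′ b<c) eq cop

  opaque
    triple : ∀ {a b c} → 0 < a → a < b → b < c → Good a b c ⊎ Dependent a b c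
    triple {a} {b} {c} 0<a a<b b<c with gcd a (gcd b c) in eq | gcd[m,n]∣m a (gcd b c) | gcd[m,n]∣n a (gcd b c)
    ... | h | divides a′ refl | h∣gcd with ∣-trans h∣gcd (gcd[m,n]∣m b c) | ∣-trans h∣gcd (gcd[m,n]∣n b c)
    ... | divides b′ refl | divides c′ refl rewrite *-comm a′ h | *-comm b′ h | *-comm c′ h =
      map⊎ (good-scale h 0<h) (dependent-scale h)
        (coprime-triple (pos h a′ 0<a) (*-cancelˡ-< h a′ b′ a<b) (*-cancelˡ-< h b′ c′ b<c)
        (*-cancelˡ-≡ _ _ h {{>-nonZero 0<h}} (begin
          h * gcd a′ (gcd b′ c′)               ≡⟨ c*gcd[m,n]≡gcd[cm,cn] h a′ (gcd b′ c′) ⟩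
          gcd (h * a′) (h * gcd b′ c′)         ≡⟨ cong (gcd (h * a′)) (c*gcd[m,n]≡gcd[cm,cn] h b′ c′) ⟩
          gcd (h * a′) (gcd (h * b′) (h * c′)) ≡⟨ eq ⟩
          h                                    ≡⟨ *-identityʳ h ⟨
          h * 1                                ∎)))
      where
      open ≡-Reasoning
      0<h : 0 < h
      0<h = n≢0⇒n>0 λ { refl → <-irrefl refl 0<a }

      pos : ∀ h a → 0 < h * a → 0 < a
      pos h zero p = ⊥-elim (<-irrefl (sym (*-zeroʳ h)) p)
      pos h (suc a) p = s≤s z≤n

  -- Quadruples all of whose triples are dependent.

  pattern y≡2x e             = inj₁ e
  pattern z≡2x e             = inj₂ (inj₁ e)
  pattern z≡2y e             = inj₂ (inj₂ (inj₁ e))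
  pattern z≡x+y e            = inj₂ (inj₂ (inj₂ (inj₁ e)))
  pattern x∶y∶z≡1∶5∶8 e e′   = inj₂ (inj₂ (inj₂ (inj₂ (inj₁ (e , e′)))))
  pattern x∶y∶z≡2∶3∶10 e e′  = inj₂ (inj₂ (inj₂ (inj₂ (inj₂ (e , e′)))))

  -- In the last form a is twice the unit, so the relations for b and c carry a factor 2; the unit
  -- is recovered in `unit-2-3-5-10`.
  data Quadruple (a b c d : ℕ) : Set where
    pairs-12-34    : b ≡ 2 * a → d ≡ 2 * c → Quadruple a b c d
    pairs-13-24    : c ≡ 2 * a → d ≡ 2 * b → Quadruple a b c d
    ratio-1-2-3-4  : b ≡ 2 * a → c ≡ 3 * a → d ≡ 4 * a → Quadruple a b c d
    ratio-1-2-4-5  : b ≡ 2 * a → c ≡ 4 * a → d ≡ 5 * a → Quadruple a b c d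
    ratio-1-4-5-8  : b ≡ 4 * a → c ≡ 5 * a → d ≡ 8 * a → Quadruple a b c d
    ratio-2-3-5-10 : 2 * b ≡ 3 * a → 2 * c ≡ 5 * a → d ≡ 5 * a → Quadruple a b c d

  ≡⇒≤ : ∀ {m n : ℕ} → m ≡ n → m ≤ n
  ≡⇒≤ = ≤-reflexive

  ≡⇒≥ : ∀ {m n : ℕ} → m ≡ n → n ≤ m
  ≡⇒≥ eq = ≤-reflexive (sym eq)

  ≡-by : ∀ m n → (m < n → ⊥) → (n < m → ⊥) → m ≡ n
  ≡-by _ _ m≮n n≮m = ≤-antisym (≮⇒≥ n≮m) (≮⇒≥ m≮n)

  opaque
    -- One inequality common to all six forms. From the triples a b c and b c d it gives 2a ≤ c and
    -- 2b ≤ d, which settle many branches without splitting those triples.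
    dependent⇒2x≤z : ∀ {x y z} → x < y → y < z → Dependent x y z → 2 * x ≤ z
    dependent⇒2x≤z x<y y<z (y≡2x refl) = <⇒≤ y<z
    dependent⇒2x≤z x<y y<z (z≡2x refl) = ≤-refl
    dependent⇒2x≤z x<y y<z (z≡2y refl) = *-monoʳ-≤ 2 (<⇒≤ x<y)
    dependent⇒2x≤z {x} x<y y<z (z≡x+y refl) = +-monoʳ-≤ x (≤-trans (≤-reflexive (+-identityʳ x)) (<⇒≤ x<y))
    dependent⇒2x≤z {x} x<y y<z (x∶y∶z≡1∶5∶8 refl refl) = *-monoˡ-≤ x {2} {8} (s≤s (s≤s z≤n))
    dependent⇒2x≤z {x} x<y y<z (x∶y∶z≡2∶3∶10 _ refl) = *-monoˡ-≤ x {2} {5} (s≤s (s≤s z≤n))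

  module _ {a b c d : ℕ} (0<a : 0 < a) (a<b : a < b) (b<c : b < c) (c<d : c < d)
           (2a≤c : 2 * a ≤ c) (2b≤d : 2 * b ≤ d) where

    opaque
      -- Each branch is a homogeneous linear system in a, b, c, d. An inconsistent one is refuted by
      -- a Farkas certificate, whose multipliers are the coefficients given to `refute`; a
      -- consistent one determines the ratios or leaves two doubling pairs.
      double-ab : b ≡ 2 * a → Dependent a c d → Dependent b c d → Quadruple a b c d
      double-ab e₂ (y≡2x e₃) _ =
        ⊥-elim (refute (≡⇒≤ e₃ ⊞ ≡⇒≥ e₂ ⊞ b<c) 0 (solve (a ∷ b ∷ c ∷ [])))
      double-ab e₂ (z≡2x e₃) _ =
        ⊥-elim (refute (≡⇒≤ e₃ ⊞ 2 ⊡ a<b ⊞ 2b≤d) 1 (solve (a ∷ b ∷ d ∷ [])))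
      double-ab e₂ (z≡2y e₃) _ =
        pairs-12-34 e₂ e₃
      double-ab e₂ (z≡x+y e₃) (y≡2x e₄) =
        ratio-1-2-4-5 e₂ (≡-by c (4 * a)
        (λ p → refute (p ⊞ 2 ⊡ ≡⇒≥ e₂ ⊞ ≡⇒≥ e₄) 0 (solve (a ∷ b ∷ c ∷ [])))
        (λ p → refute (≡⇒≤ e₄ ⊞ 2 ⊡ ≡⇒≤ e₂ ⊞ p) 0 (solve (a ∷ b ∷ c ∷ [])))) (≡-by d (5 * a)
        (λ p → refute (2 ⊡ ≡⇒≥ e₂ ⊞ ≡⇒≥ e₄ ⊞ p ⊞ ≡⇒≥ e₃) 0 (solve (a ∷ b ∷ c ∷ d ∷ [])))
        (λ p → refute (≡⇒≤ e₃ ⊞ p ⊞ ≡⇒≤ e₄ ⊞ 2 ⊡ ≡⇒≤ e₂) 0 (solve (a ∷ b ∷ c ∷ d ∷ []))))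
      double-ab e₂ (z≡x+y e₃) (z≡2x e₄) =
        ratio-1-2-3-4 e₂ (≡-by c (3 * a)
        (λ p → refute (≡⇒≤ e₃ ⊞ 2 ⊡ ≡⇒≥ e₂ ⊞ ≡⇒≥ e₄ ⊞ p) 0 (solve (a ∷ b ∷ c ∷ d ∷ [])))
        (λ p → refute (p ⊞ ≡⇒≤ e₄ ⊞ 2 ⊡ ≡⇒≤ e₂ ⊞ ≡⇒≥ e₃) 0 (solve (a ∷ b ∷ c ∷ d ∷ [])))) (≡-by d (4 * a)
        (λ p → refute (p ⊞ 2 ⊡ ≡⇒≥ e₂ ⊞ ≡⇒≥ e₄) 0 (solve (a ∷ b ∷ d ∷ [])))
        (λ p → refute (≡⇒≤ e₄ ⊞ 2 ⊡ ≡⇒≤ e₂ ⊞ p) 0 (solve (a ∷ b ∷ d ∷ []))))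
      double-ab e₂ (z≡x+y e₃) (z≡2y e₄) =
        ⊥-elim (refute (≡⇒≤ e₃ ⊞ a<b ⊞ b<c ⊞ ≡⇒≥ e₄) 1 (solve (a ∷ b ∷ c ∷ d ∷ [])))
      double-ab e₂ (z≡x+y e₃) (z≡x+y e₄) =
        ⊥-elim (refute (≡⇒≤ e₃ ⊞ a<b ⊞ ≡⇒≥ e₄) 0 (solve (a ∷ b ∷ c ∷ d ∷ [])))
      double-ab e₂ (z≡x+y e₃) (x∶y∶z≡1∶5∶8 e₄ e₄′) =
        ⊥-elim (refute (2 ⊡ ≡⇒≤ e₃ ⊞ 2 ⊡ a<b ⊞ b<c ⊞ 3 ⊡ ≡⇒≤ e₄ ⊞ 2 ⊡ ≡⇒≥ e₄′) 2 (solve (a ∷ b ∷ c ∷ d ∷ [])))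
      double-ab e₂ (z≡x+y e₃) (x∶y∶z≡2∶3∶10 e₄ e₄′) =
        ⊥-elim (refute (5 ⊡ 2b≤d ⊞ 6 ⊡ ≡⇒≤ e₃ ⊞ 6 ⊡ a<b ⊞ ≡⇒≥ e₄′ ⊞ 3 ⊡ ≡⇒≤ e₄) 5 (solve (a ∷ b ∷ c ∷ d ∷ [])))
      double-ab e₂ (x∶y∶z≡1∶5∶8 e₃ e₃′) (y≡2x e₄) =
        ⊥-elim (refute (2 ⊡ 0<a ⊞ 2a≤c ⊞ 5 ⊡ ≡⇒≤ e₄ ⊞ 10 ⊡ ≡⇒≤ e₂ ⊞ 4 ⊡ ≡⇒≥ e₃) 1 (solve (a ∷ b ∷ c ∷ [])))
      double-ab e₂ (x∶y∶z≡1∶5∶8 e₃ e₃′) (z≡2x e₄) =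
        ⊥-elim (refute (≡⇒≤ e₄ ⊞ 6 ⊡ ≡⇒≤ e₂ ⊞ 4 ⊡ a<b ⊞ ≡⇒≥ e₃′) 3 (solve (a ∷ b ∷ d ∷ [])))
      double-ab e₂ (x∶y∶z≡1∶5∶8 e₃ e₃′) (z≡2y e₄) =
        ⊥-elim (refute (5 ⊡ ≡⇒≤ e₃′ ⊞ 8 ⊡ ≡⇒≥ e₃ ⊞ 2 ⊡ c<d ⊞ 3 ⊡ ≡⇒≥ e₄) 1 (solve (a ∷ c ∷ d ∷ [])))
      double-ab e₂ (x∶y∶z≡1∶5∶8 e₃ e₃′) (z≡x+y e₄) =
        ⊥-elim (refute (0<a ⊞ ≡⇒≥ e₃′ ⊞ ≡⇒≤ e₄ ⊞ ≡⇒≤ e₂ ⊞ ≡⇒≤ e₃) 0 (solve (a ∷ b ∷ c ∷ d ∷ [])))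
      double-ab e₂ (x∶y∶z≡1∶5∶8 e₃ e₃′) (x∶y∶z≡1∶5∶8 e₄ e₄′) =
        ⊥-elim (refute (≡⇒≤ e₃ ⊞ 5 ⊡ a<b ⊞ ≡⇒≥ e₄) 4 (solve (a ∷ b ∷ c ∷ [])))
      double-ab e₂ (x∶y∶z≡1∶5∶8 e₃ e₃′) (x∶y∶z≡2∶3∶10 e₄ e₄′) =
        ⊥-elim (refute (8 ⊡ 0<a ⊞ 4 ⊡ 2a≤c ⊞ 5 ⊡ ≡⇒≤ e₄ ⊞ 15 ⊡ ≡⇒≤ e₂ ⊞ 6 ⊡ ≡⇒≥ e₃) 7 (solve (a ∷ b ∷ c ∷ [])))
      double-ab e₂ (x∶y∶z≡2∶3∶10 e₃ e₃′) _ =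
        ⊥-elim (refute (0<a ⊞ 2 ⊡ 2a≤c ⊞ ≡⇒≤ e₃) 0 (solve (a ∷ c ∷ [])))

    opaque
      double-bd : d ≡ 2 * b → Dependent a b c → Dependent a c d → Quadruple a b c d
      double-bd e₂ _ (y≡2x e₃) =
        pairs-13-24 e₃ e₂
      double-bd e₂ _ (z≡2x e₃) =
        ⊥-elim (refute (≡⇒≤ e₃ ⊞ 2 ⊡ a<b ⊞ ≡⇒≥ e₂) 1 (solve (a ∷ b ∷ d ∷ [])))
      double-bd e₂ _ (z≡2y e₃) =
        ⊥-elim (refute (≡⇒≤ e₂ ⊞ 2 ⊡ b<c ⊞ ≡⇒≥ e₃) 1 (solve (b ∷ c ∷ d ∷ [])))
      double-bd e₂ (y≡2x e₁) (z≡x+y e₃) =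
        ratio-1-2-3-4 e₁ (≡-by c (3 * a)
        (λ p → refute (≡⇒≤ e₃ ⊞ 2 ⊡ ≡⇒≥ e₁ ⊞ ≡⇒≥ e₂ ⊞ p) 0 (solve (a ∷ b ∷ c ∷ d ∷ [])))
        (λ p → refute (p ⊞ ≡⇒≤ e₂ ⊞ 2 ⊡ ≡⇒≤ e₁ ⊞ ≡⇒≥ e₃) 0 (solve (a ∷ b ∷ c ∷ d ∷ [])))) (≡-by d (4 * a)
        (λ p → refute (p ⊞ 2 ⊡ ≡⇒≥ e₁ ⊞ ≡⇒≥ e₂) 0 (solve (a ∷ b ∷ d ∷ [])))
        (λ p → refute (≡⇒≤ e₂ ⊞ 2 ⊡ ≡⇒≤ e₁ ⊞ p) 0 (solve (a ∷ b ∷ d ∷ []))))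
      double-bd e₂ (z≡2x e₁) (z≡x+y e₃) =
        pairs-13-24 e₁ e₂
      double-bd e₂ (z≡2y e₁) (z≡x+y e₃) =
        ⊥-elim (refute (≡⇒≤ e₂ ⊞ ≡⇒≥ e₁ ⊞ c<d) 0 (solve (b ∷ c ∷ d ∷ [])))
      double-bd e₂ (z≡x+y e₁) (z≡x+y e₃) =
        ratio-1-2-3-4 (≡-by b (2 * a)
        (λ p → refute (≡⇒≤ e₂ ⊞ ≡⇒≥ e₁ ⊞ p ⊞ ≡⇒≥ e₃) 0 (solve (a ∷ b ∷ c ∷ d ∷ [])))
        (λ p → refute (≡⇒≤ e₃ ⊞ p ⊞ ≡⇒≥ e₂ ⊞ ≡⇒≤ e₁) 0 (solve (a ∷ b ∷ c ∷ d ∷ [])))) (≡-by c (3 * a)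
        (λ p → refute (≡⇒≤ e₂ ⊞ 2 ⊡ ≡⇒≥ e₁ ⊞ p ⊞ ≡⇒≥ e₃) 0 (solve (a ∷ b ∷ c ∷ d ∷ [])))
        (λ p → refute (≡⇒≤ e₃ ⊞ p ⊞ 2 ⊡ ≡⇒≤ e₁ ⊞ ≡⇒≥ e₂) 0 (solve (a ∷ b ∷ c ∷ d ∷ [])))) (≡-by d (4 * a)
        (λ p → refute (≡⇒≤ e₂ ⊞ 2 ⊡ ≡⇒≥ e₁ ⊞ p ⊞ 2 ⊡ ≡⇒≥ e₃) 0 (solve (a ∷ b ∷ c ∷ d ∷ [])))
        (λ p → refute (2 ⊡ ≡⇒≤ e₃ ⊞ p ⊞ 2 ⊡ ≡⇒≤ e₁ ⊞ ≡⇒≥ e₂) 0 (solve (a ∷ b ∷ c ∷ d ∷ []))))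
      double-bd e₂ (x∶y∶z≡1∶5∶8 e₁ e₁′) (z≡x+y e₃) =
        ⊥-elim (refute (0<a ⊞ a<b ⊞ 5 ⊡ ≡⇒≥ e₂ ⊞ 5 ⊡ ≡⇒≤ e₃ ⊞ 5 ⊡ ≡⇒≤ e₁′ ⊞ 9 ⊡ ≡⇒≥ e₁) 1 (solve (a ∷ b ∷ c ∷ d ∷ [])))
      double-bd e₂ (x∶y∶z≡2∶3∶10 e₁ e₁′) (z≡x+y e₃) =
        ⊥-elim (refute (2 ⊡ 0<a ⊞ 2 ⊡ a<b ⊞ ≡⇒≥ e₁′ ⊞ ≡⇒≤ e₂ ⊞ 2 ⊡ ≡⇒≤ e₁ ⊞ ≡⇒≥ e₃) 3 (solve (a ∷ b ∷ c ∷ d ∷ [])))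
      double-bd e₂ _ (x∶y∶z≡1∶5∶8 e₃ e₃′) =
        ratio-1-4-5-8 (≡-by b (4 * a)
        (λ p → refute (≡⇒≤ e₂ ⊞ 2 ⊡ p ⊞ ≡⇒≥ e₃′) 1 (solve (a ∷ b ∷ d ∷ [])))
        (λ p → refute (≡⇒≤ e₃′ ⊞ 2 ⊡ p ⊞ ≡⇒≥ e₂) 1 (solve (a ∷ b ∷ d ∷ [])))) e₃ e₃′
      double-bd e₂ _ (x∶y∶z≡2∶3∶10 e₃ e₃′) =
        ⊥-elim (refute (0<a ⊞ 2 ⊡ 2a≤c ⊞ ≡⇒≤ e₃) 0 (solve (a ∷ c ∷ [])))

    opaque
      -- With a, b, d in ratio 2 : 3 : 10 the candidates for c are mainly 4, 5 and 6. The value 4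
      -- fails at the triple 3, 4, 10 and 6 fails at 2, 6, 10, so 5 survives.
      two-three-ten : 2 * b ≡ 3 * a → d ≡ 5 * a →
                    Dependent a b c → Dependent a c d → Dependent b c d → Quadruple a b c d
      two-three-ten e₂ e₂′ (y≡2x e₁) _ _ =
        ⊥-elim (refute (0<a ⊞ a<b ⊞ 2 ⊡ ≡⇒≤ e₂ ⊞ 3 ⊡ ≡⇒≥ e₁) 1 (solve (a ∷ b ∷ [])))
      two-three-ten e₂ e₂′ (z≡2x e₁) _ (y≡2x e₄) =
        ⊥-elim (refute (≡⇒≤ e₁ ⊞ 2 ⊡ a<b ⊞ ≡⇒≥ e₄) 1 (solve (a ∷ b ∷ c ∷ [])))
      two-three-ten e₂ e₂′ (z≡2x e₁) _ (z≡2x e₄) =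
        ⊥-elim (refute (2 ⊡ 0<a ⊞ ≡⇒≥ e₂′ ⊞ ≡⇒≤ e₄ ⊞ ≡⇒≤ e₂) 1 (solve (a ∷ b ∷ d ∷ [])))
      two-three-ten e₂ e₂′ (z≡2x e₁) _ (z≡2y e₄) =
        ⊥-elim (refute (0<a ⊞ ≡⇒≥ e₂′ ⊞ ≡⇒≤ e₄ ⊞ 2 ⊡ ≡⇒≤ e₁) 0 (solve (a ∷ c ∷ d ∷ [])))
      two-three-ten e₂ e₂′ (z≡2x e₁) _ (z≡x+y e₄) =
        ⊥-elim (refute (0<a ⊞ ≡⇒≥ e₂′ ⊞ ≡⇒≤ e₄ ⊞ b<c ⊞ 2 ⊡ ≡⇒≤ e₁) 1 (solve (a ∷ b ∷ c ∷ d ∷ [])))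
      two-three-ten e₂ e₂′ (z≡2x e₁) _ (x∶y∶z≡1∶5∶8 e₄ e₄′) =
        ⊥-elim (refute (6 ⊡ 0<a ⊞ 3 ⊡ 2a≤c ⊞ 5 ⊡ ≡⇒≤ e₁ ⊞ 10 ⊡ a<b ⊞ 2 ⊡ ≡⇒≥ e₄) 15 (solve (a ∷ b ∷ c ∷ [])))
      two-three-ten e₂ e₂′ (z≡2x e₁) _ (x∶y∶z≡2∶3∶10 e₄ e₄′) =
        ⊥-elim (refute (≡⇒≤ e₂′ ⊞ 5 ⊡ a<b ⊞ ≡⇒≥ e₄′) 4 (solve (a ∷ b ∷ d ∷ [])))
      two-three-ten e₂ e₂′ (z≡2y e₁) (y≡2x e₃) _ =
        ⊥-elim (refute (≡⇒≤ e₃ ⊞ 2 ⊡ a<b ⊞ ≡⇒≥ e₁) 1 (solve (a ∷ b ∷ c ∷ [])))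
      two-three-ten e₂ e₂′ (z≡2y e₁) (z≡2x e₃) _ =
        ⊥-elim (refute (≡⇒≤ e₃ ⊞ 2 ⊡ a<b ⊞ 2b≤d) 1 (solve (a ∷ b ∷ d ∷ [])))
      two-three-ten e₂ e₂′ (z≡2y e₁) (z≡2y e₃) _ =
        ⊥-elim (refute (0<a ⊞ ≡⇒≤ e₂′ ⊞ 2 ⊡ ≡⇒≥ e₂ ⊞ 2 ⊡ ≡⇒≥ e₁ ⊞ ≡⇒≥ e₃) 0 (solve (a ∷ b ∷ c ∷ d ∷ [])))
      two-three-ten e₂ e₂′ (z≡2y e₁) (z≡x+y e₃) _ =
        ⊥-elim (refute (3 ⊡ ≡⇒≤ e₃ ⊞ 2 ⊡ b<c ⊞ 5 ⊡ ≡⇒≤ e₁ ⊞ 4 ⊡ ≡⇒≤ e₂ ⊞ 3 ⊡ ≡⇒≥ e₂′) 1 (solve (a ∷ b ∷ c ∷ d ∷ [])))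
      two-three-ten e₂ e₂′ (z≡2y e₁) (x∶y∶z≡1∶5∶8 e₃ e₃′) _ =
        ⊥-elim (refute (4 ⊡ 0<a ⊞ 2 ⊡ 2a≤c ⊞ 5 ⊡ ≡⇒≤ e₁ ⊞ 5 ⊡ ≡⇒≤ e₂ ⊞ 3 ⊡ ≡⇒≥ e₃) 3 (solve (a ∷ b ∷ c ∷ [])))
      two-three-ten e₂ e₂′ (z≡2y e₁) (x∶y∶z≡2∶3∶10 e₃ e₃′) _ =
        ⊥-elim (refute (≡⇒≤ e₃ ⊞ ≡⇒≥ e₂ ⊞ 2 ⊡ b<c) 1 (solve (a ∷ b ∷ c ∷ [])))
      two-three-ten e₂ e₂′ (z≡x+y e₁) _ _ =
        ratio-2-3-5-10 e₂ (≡-by (2 * c) (5 * a)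
        (λ p → refute (≡⇒≥ e₂ ⊞ p ⊞ 2 ⊡ ≡⇒≥ e₁) 0 (solve (a ∷ b ∷ c ∷ [])))
        (λ p → refute (2 ⊡ ≡⇒≤ e₁ ⊞ ≡⇒≤ e₂ ⊞ p) 0 (solve (a ∷ b ∷ c ∷ [])))) e₂′
      two-three-ten e₂ e₂′ (x∶y∶z≡1∶5∶8 e₁ e₁′) _ _ =
        ⊥-elim (refute (7 ⊡ 0<a ⊞ 7 ⊡ a<b ⊞ 5 ⊡ ≡⇒≤ e₂ ⊞ 3 ⊡ ≡⇒≥ e₁) 13 (solve (a ∷ b ∷ [])))
      two-three-ten e₂ e₂′ (x∶y∶z≡2∶3∶10 e₁ e₁′) _ _ =
        ⊥-elim (refute (≡⇒≤ e₂′ ⊞ ≡⇒≥ e₁′ ⊞ c<d) 0 (solve (a ∷ c ∷ d ∷ [])))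

    opaque
      -- The triple a b d is split first because 2b ≤ d leaves it only three forms: 2a and a + b are
      -- below 2b, and in ratio 1 : 5 : 8 the largest element is below twice the middle one.
      quadruple′ : Dependent a b c → Dependent a b d → Dependent a c d → Dependent b c d → Quadruple a b c d
      quadruple′ D₁ (y≡2x e₂) D₃ D₄ = double-ab e₂ D₃ D₄
      quadruple′ D₁ (z≡2x e₂) D₃ D₄ =
        ⊥-elim (refute (≡⇒≤ e₂ ⊞ 2 ⊡ a<b ⊞ 2b≤d) 1 (solve (a ∷ b ∷ d ∷ [])))
      quadruple′ D₁ (z≡2y e₂) D₃ D₄ = double-bd e₂ D₁ D₃
      quadruple′ D₁ (z≡x+y e₂) D₃ D₄ =
        ⊥-elim (refute (≡⇒≤ e₂ ⊞ a<b ⊞ 2b≤d) 0 (solve (a ∷ b ∷ d ∷ [])))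
      quadruple′ D₁ (x∶y∶z≡1∶5∶8 e₂ e₂′) D₃ D₄ =
        ⊥-elim (refute (2 ⊡ 0<a ⊞ ≡⇒≤ e₂′ ⊞ 2 ⊡ ≡⇒≥ e₂ ⊞ 2b≤d) 1 (solve (a ∷ b ∷ d ∷ [])))
      quadruple′ D₁ (x∶y∶z≡2∶3∶10 e₂ e₂′) D₃ D₄ = two-three-ten e₂ e₂′ D₁ D₃ D₄

  quadruple : ∀ {a b c d} → 0 < a → a < b → b < c → c < d →
              Dependent a b c → Dependent a b d → Dependent a c d → Dependent b c d → Quadruple a b c d
  quadruple 0<a a<b b<c c<d D₁ D₂ D₃ D₄ = quadruple′ 0<a a<b b<c c<d
    (dependent⇒2x≤z a<b b<c D₁) (dependent⇒2x≤z b<c c<d D₄) D₁ D₂ D₃ D₄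

-- The functions f(a x) on cells of length 1/(3P), and the existence of the maximum.

module Cells where

  open import Data.Integer as ℤ using (ℤ; +_; 1ℤ; 0ℤ)
  open import Data.Integer.DivMod using (_/ℕ_; _%ℕ_; a≡a%ℕn+[a/ℕn]*n; n%ℕd<d)
  import Data.Integer.Properties as ℤ
  import Data.Integer.Tactic.RingSolver as ℤ-Ring
  open import Data.List.Relation.Binary.Permutation.Propositional using (_↭_; refl; prep; swap; trans)
  open import Data.List.Relation.Unary.All using (All; []; _∷_)
  open import Data.Nat as ℕ using (ℕ; zero; suc; z≤n; s≤s)
  open import Data.Nat.Divisibility using (_∣_; divides)
  import Data.Nat.DivMod as ℕ
  import Data.Nat.Properties as ℕ
  open import Data.Product using (∃-syntax; _×_; _,_; proj₁; proj₂)
  open import Data.Rational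
  open import Data.Rational.Literals using (fromℤ)
  open import Data.Rational.Properties
  open import Data.Sum using (inj₁; inj₂)
  open import Relation.Binary using (tri<; tri≈; tri>)
  open import Relation.Binary.PropositionalEquality hiding (trans) renaming (refl to ≡-refl)
  import Relation.Binary.PropositionalEquality as ≡
  open import Relation.Nullary using (¬_)
  open import Relation.Nullary.Decidable using (Dec; yes; no; _×-dec_; decidable-stable)

  opaque
    fromℤ-+ : ∀ m n → fromℤ m + fromℤ n ≡ fromℤ (m ℤ.+ n)
    fromℤ-+ m n = ≡.trans (cong (_/ 1) (cong₂ ℤ._+_ (ℤ.*-identityʳ m) (ℤ.*-identityʳ n)))
                        (↥p/↧p≡p (fromℤ (m ℤ.+ n)))

    fromℤ-* : ∀ m n → fromℤ m * fromℤ n ≡ fromℤ (m ℤ.* n)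
    fromℤ-* m n = ↥p/↧p≡p (fromℤ (m ℤ.* n))

    fromℤ-≤ : ∀ {m n} → m ℤ.≤ n → fromℤ m ≤ fromℤ n
    fromℤ-≤ {m} {n} m≤n = *≤* (subst₂ ℤ._≤_ (sym (ℤ.*-identityʳ m)) (sym (ℤ.*-identityʳ n)) m≤n)

    U-resp-≤ : ∀ x {q r} → q ≤ r → U x q → U x r
    U-resp-≤ x {q} {r} q≤r Uq with <-cmp q r
    ... | tri< q<r _ _  = U-closed x q<r Uq
    ... | tri≈ _ ≡-refl _ = Uq
    ... | tri> _ _ r<q  = ⊥-elim (<-irrefl ≡-refl (<-≤-trans r<q q≤r))

    cross-≤ : ∀ {x y} a b .{{_ : Positive a}} .{{_ : Positive b}} .{{_ : NonZero a}} .{{_ : NonZero b}} →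
              x * b ≤ y * a → x * 1/ a ≤ y * 1/ b
    cross-≤ {x} {y} a b p = *-cancelʳ-≤-pos a (*-cancelʳ-≤-pos b
      (subst₂ _≤_ (sym (left x)) (sym right) p))
      where
      left : ∀ x → x * 1/ a * a * b ≡ x * b
      left x = cong (_* b) (≡.trans (*-assoc x (1/ a) a) (≡.trans (cong (x *_) (*-inverseˡ a)) (*-identityʳ x)))

      right : y * 1/ b * a * b ≡ y * a
      right = begin
        y * 1/ b * a * b      ≡⟨ *-assoc (y * 1/ b) a b ⟩
        y * 1/ b * (a * b)    ≡⟨ cong (y * 1/ b *_) (*-comm a b) ⟩
        y * 1/ b * (b * a)    ≡⟨ *-assoc (y * 1/ b) b a ⟨
        y * 1/ b * b * a      ≡⟨ cong (_* a) (*-assoc y (1/ b) b) ⟩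
        y * (1/ b * b) * a    ≡⟨ cong (λ z → y * z * a) (*-inverseˡ b) ⟩
        y * 1ℚ * a            ≡⟨ cong (_* a) (*-identityʳ y) ⟩
        y * a                 ∎
        where open ≡-Reasoning

  opaque
    inside? : ∀ P m → Dec (P ℕ.≤ m × m ℕ.< 2 ℕ.* P)
    inside? P m = (P ℕ.≤? m) ×-dec (m ℕ.<? 2 ℕ.* P)

  χ : ∀ {X : Set} → Dec X → ℚ
  χ (yes _) = 1ℚ
  χ (no _)  = 0ℚ

  cellValue : ℕ → ℕ → ℚ
  cellValue P m = χ (inside? P m) - ⅓

  -- k / N ≤ x < (k + 1) / N
  Cell : ℕ → ℝ → ℤ → Set
  Cell N x k = ((N · x) ⊖ k) ∈[ 0ℚ , 1ℚ ⟩

  module _ {a′ e p : ℕ} (P≡ea : suc p ≡ e ℕ.* suc a′) {x : ℝ} {k q : ℤ} {m : ℕ}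
           (cell : Cell (3 ℕ.* suc p) x k) (residue : + suc a′ ℤ.* k ≡ + m ℤ.+ q ℤ.* + (3 ℕ.* suc p)) where

    private
      a P N : ℕ
      a = suc a′
      P = suc p
      N = 3 ℕ.* P

      A Nℚ : ℚ
      A = fromℤ (+ a)
      Nℚ = fromℤ (+ N)

    opaque
      -- `r` is one of 0, ⅓, ⅔, 1, written as u/3: the ends of the period and the jumps of f are
      -- treated uniformly.
      threshold : ∀ r u → r * fromℤ (+ 3) ≡ fromℤ (+ u) → (r + fromℤ q) * Nℚ ≡ fromℤ (+ (u ℕ.* P) ℤ.+ q ℤ.* + N)
      threshold r u 3r≡u = begin
        (r + fromℤ q) * Nℚ                                  ≡⟨ *-distribʳ-+ Nℚ r (fromℤ q) ⟩
        r * Nℚ + fromℤ q * Nℚ                               ≡⟨ cong₂ _+_ rN (fromℤ-* q (+ N)) ⟩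
        fromℤ (+ (u ℕ.* P)) + fromℤ (q ℤ.* + N)             ≡⟨ fromℤ-+ (+ (u ℕ.* P)) (q ℤ.* + N) ⟩
        fromℤ (+ (u ℕ.* P) ℤ.+ q ℤ.* + N)                   ∎
        where
        open ≡-Reasoning
        rN : r * Nℚ ≡ fromℤ (+ (u ℕ.* P))
        rN = begin
          r * fromℤ (+ (3 ℕ.* P))             ≡⟨ cong (λ z → r * fromℤ z) (ℤ.pos-* 3 P) ⟩
          r * fromℤ (+ 3 ℤ.* + P)             ≡⟨ cong (r *_) (fromℤ-* (+ 3) (+ P)) ⟨
          r * (fromℤ (+ 3) * fromℤ (+ P))     ≡⟨ *-assoc r (fromℤ (+ 3)) (fromℤ (+ P)) ⟨
          r * fromℤ (+ 3) * fromℤ (+ P)       ≡⟨ cong (_* fromℤ (+ P)) 3r≡u ⟩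
          fromℤ (+ u) * fromℤ (+ P)           ≡⟨ fromℤ-* (+ u) (+ P) ⟩
          fromℤ (+ u ℤ.* + P)                 ≡⟨ cong fromℤ (ℤ.pos-* u P) ⟨
          fromℤ (+ (u ℕ.* P))                 ∎

      not-above : ∀ r u → r * fromℤ (+ 3) ≡ fromℤ (+ u) → u ℕ.* P ℕ.≤ m → ¬ U ((a · x) ⊖ q) r
      not-above r u 3r≡u uP≤m Ur = proj₁ cell (U-resp-≤ x
        (cross-≤ {r + fromℤ q} {0ℚ + fromℤ k} A Nℚ (subst₂ _≤_ (sym (threshold r u 3r≡u)) kA
          (fromℤ-≤ (ℤ.+-monoˡ-≤ (q ℤ.* + N) (ℤ.+≤+ uP≤m))))) Ur)
        where
        kA : fromℤ (+ m ℤ.+ q ℤ.* + N) ≡ (0ℚ + fromℤ k) * A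
        kA = begin
          fromℤ (+ m ℤ.+ q ℤ.* + N)     ≡⟨ cong fromℤ residue ⟨
          fromℤ (+ a ℤ.* k)             ≡⟨ fromℤ-* (+ a) k ⟨
          A * fromℤ k                   ≡⟨ *-comm A (fromℤ k) ⟩
          fromℤ k * A                   ≡⟨ cong (_* A) (+-identityˡ (fromℤ k)) ⟨
          (0ℚ + fromℤ k) * A            ∎
          where open ≡-Reasoning

      -- Both m and u P are multiples of a.
      residue-gap : ∀ u → m ℕ.< u ℕ.* P → + a ℤ.+ + m ℤ.≤ + (u ℕ.* P)
      residue-gap u m<uP = subst₂ ℤ._≤_ (≡.trans (l₂ (+ a) k q (+ e)) (cong (λ z → + a ℤ.+ z) (sym m≡))) (sym uP≡)
        (ℤ.*-monoʳ-≤-nonNeg (+ a) (ℤ.i<j⇒suc[i]≤j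
          (ℤ.*-cancelʳ-<-nonNeg {k ℤ.- + 3 ℤ.* q ℤ.* + e} {+ u ℤ.* + e} (+ a) (subst₂ ℤ._<_ m≡ uP≡ (ℤ.+<+ m<uP)))))
        where
        l₁ : ∀ a k q e m → a ℤ.* k ≡ m ℤ.+ q ℤ.* (+ 3 ℤ.* (e ℤ.* a)) → m ≡ (k ℤ.- + 3 ℤ.* q ℤ.* e) ℤ.* a
        l₁ a k q e m eq = begin
          m
            ≡⟨ s₁ m (q ℤ.* (+ 3 ℤ.* (e ℤ.* a))) ⟩
          (m ℤ.+ q ℤ.* (+ 3 ℤ.* (e ℤ.* a))) ℤ.- q ℤ.* (+ 3 ℤ.* (e ℤ.* a))
            ≡⟨ cong (λ z → z ℤ.- q ℤ.* (+ 3 ℤ.* (e ℤ.* a))) eq ⟨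
          a ℤ.* k ℤ.- q ℤ.* (+ 3 ℤ.* (e ℤ.* a))                                        ≡⟨ s₂ a k q e ⟩
          (k ℤ.- + 3 ℤ.* q ℤ.* e) ℤ.* a                                                ∎
          where
          open ≡-Reasoning
          s₁ : ∀ m y → m ≡ (m ℤ.+ y) ℤ.- y
          s₁ = ℤ-Ring.solve-∀
          s₂ : ∀ a k q e → a ℤ.* k ℤ.- q ℤ.* (+ 3 ℤ.* (e ℤ.* a)) ≡ (k ℤ.- + 3 ℤ.* q ℤ.* e) ℤ.* a
          s₂ = ℤ-Ring.solve-∀

        l₂ : ∀ a k q e → (1ℤ ℤ.+ (k ℤ.- + 3 ℤ.* q ℤ.* e)) ℤ.* a ≡ a ℤ.+ (k ℤ.- + 3 ℤ.* q ℤ.* e) ℤ.* a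
        l₂ = ℤ-Ring.solve-∀

        P≡ : + P ≡ + e ℤ.* + a
        P≡ = ≡.trans (cong +_ P≡ea) (ℤ.pos-* e a)

        m≡ : + m ≡ (k ℤ.- + 3 ℤ.* q ℤ.* + e) ℤ.* + a
        m≡ = l₁ (+ a) k q (+ e) (+ m)
          (≡.trans residue (cong (λ n → + m ℤ.+ q ℤ.* n) (≡.trans (ℤ.pos-* 3 P) (cong (λ z → + 3 ℤ.* z) P≡))))

        uP≡ : + (u ℕ.* P) ≡ + u ℤ.* + e ℤ.* + a
        uP≡ = ≡.trans (ℤ.pos-* u P) (≡.trans (cong (λ z → + u ℤ.* z) P≡) (sym (ℤ.*-assoc (+ u) (+ e) (+ a))))

      -- The right end (k + 1)/N of the cell must not exceed the threshold (r + q)/a, which needs a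
      -- whole gap a between m and u P. `residue-gap` supplies it: no jump of f(a x) falls strictly
      -- inside a cell.
      above : ∀ r u → r * fromℤ (+ 3) ≡ fromℤ (+ u) → m ℕ.< u ℕ.* P → U ((a · x) ⊖ q) r
      above r u 3r≡u m<uP = U-resp-≤ x
        (cross-≤ {1ℚ + fromℤ k} {r + fromℤ q} Nℚ A (subst₂ _≤_ kA (sym (threshold r u 3r≡u))
          (fromℤ-≤ (ℤ.+-monoˡ-≤ (q ℤ.* + N) (residue-gap u m<uP))))) (proj₂ cell)
        where
        kA : fromℤ (+ a ℤ.+ + m ℤ.+ q ℤ.* + N) ≡ (1ℚ + fromℤ k) * A
        kA = begin
          fromℤ (+ a ℤ.+ + m ℤ.+ q ℤ.* + N)       ≡⟨ cong fromℤ (ℤ.+-assoc (+ a) (+ m) (q ℤ.* + N)) ⟩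
          fromℤ (+ a ℤ.+ (+ m ℤ.+ q ℤ.* + N))     ≡⟨ cong (λ z → fromℤ (+ a ℤ.+ z)) residue ⟨
          fromℤ (+ a ℤ.+ + a ℤ.* k)               ≡⟨ fromℤ-+ (+ a) (+ a ℤ.* k) ⟨
          A + fromℤ (+ a ℤ.* k)                   ≡⟨ cong (λ z → A + z) (fromℤ-* (+ a) k) ⟨
          A + A * fromℤ k                         ≡⟨ cong (λ z → z + A * fromℤ k) (*-identityʳ A) ⟨
          A * 1ℚ + A * fromℤ k                    ≡⟨ *-distribˡ-+ A 1ℚ (fromℤ k) ⟨
          A * (1ℚ + fromℤ k)                      ≡⟨ *-comm A (1ℚ + fromℤ k) ⟩
          (1ℚ + fromℤ k) * A                      ∎
          where open ≡-Reasoning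

    opaque
      -- With N = 3P the middle third of the residues is P ≤ m < 2P, and `q` is the floor of a x.
      -- All comparisons of reals have become comparisons of integers.
      f-cell : m ℕ.< N → f (a · x) (cellValue P m)
      f-cell m<N with inside? P m
      ... | yes (lo , hi) = q , (not-above 0ℚ 0 ≡-refl z≤n , above 1ℚ 3 ≡-refl m<N) , 1ℚ
          , inside (not-above ⅓ 1 ≡-refl (subst (ℕ._≤ m) (sym (ℕ.*-identityˡ P)) lo) , above ⅔ 2 ≡-refl hi) , ≡-refl
      ... | no  ¬in = q , (not-above 0ℚ 0 ≡-refl z≤n , above 1ℚ 3 ≡-refl m<N) , 0ℚ
          , outside (λ (lo , hi) → ¬in
            (ℕ.≮⇒≥ (λ m<P → lo (above ⅓ 1 ≡-refl (subst (m ℕ.<_) (sym (ℕ.*-identityˡ P)) m<P)))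
                                       , ℕ.≰⇒> (λ 2P≤m → not-above ⅔ 2 ≡-refl 2P≤m hi))) , ≡-refl

  opaque
    fSum-unique : ∀ A x {y z} → fSum A x y → fSum A x z → y ≡ z
    fSum-unique []      x ≡-refl ≡-refl = ≡-refl
    fSum-unique (a ∷ A) x (_ , _ , fy , Fy , ≡-refl) (_ , _ , fz , Fz , ≡-refl) =
      cong₂ _+_ (f-unique (a · x) fy fz) (fSum-unique A x Fy Fz)

  opaque
    fSum-↭ : ∀ {A B x w} → A ↭ B → fSum A x w → fSum B x w
    fSum-↭ refl S = S
    fSum-↭ (prep a A↭B) (y , z , fy , S , eq) = y , z , fy , fSum-↭ A↭B S , eq
    fSum-↭ (swap a b A↭B) (y , _ , fy , (y′ , z , fy′ , S , ≡-refl) , ≡-refl) =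
      y′ , y + z , fy′ , (y , z , fy , fSum-↭ A↭B S , ≡-refl) , exchange
      where
      open ≡-Reasoning
      exchange : y + (y′ + z) ≡ y′ + (y + z)
      exchange = begin
        y + (y′ + z)   ≡⟨ +-assoc y y′ z ⟨
        y + y′ + z     ≡⟨ cong (λ s → s + z) (+-comm y y′) ⟩
        y′ + y + z     ≡⟨ +-assoc y′ y z ⟩
        y′ + (y + z)   ∎
    fSum-↭ (trans A↭B B↭C) S = fSum-↭ B↭C (fSum-↭ A↭B S)

  opaque
    extend : ∀ n (g : ℕ → ℚ) {q} → (∀ j → j ℕ.≤ n → g j ≤ q) → g (suc n) ≤ q → ∀ j → j ℕ.≤ suc n → g j ≤ q
    extend n g below last j j≤ with ℕ.m≤n⇒m<n∨m≡n j≤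
    ... | inj₁ (s≤s j≤n) = below j j≤n
    ... | inj₂ ≡-refl    = last

  opaque
    argmax : ∀ n (g : ℕ → ℚ) → ∃[ k ] (∀ j → j ℕ.≤ n → g j ≤ g k)
    argmax zero g = 0 , λ { zero z≤n → ≤-refl }
    argmax (suc n) g with argmax n g
    ... | k , max with ≤-total (g k) (g (suc n))
    ... | inj₁ gk≤ = suc n , extend n g (λ j j≤n → ≤-trans (max j j≤n) gk≤) ≤-refl
    ... | inj₂ ≤gk = k , extend n g max ≤gk

  point : ℕ → ℤ → ℝ
  point n k = fromℚ (fromℤ k * 1/ fromℤ (+ suc n))

  opaque
    point-cell : ∀ n k → Cell (suc n) (point n k) k
    point-cell n k =
        (λ p< → <-irrefl (cong (_* 1/N) (sym (+-identityˡ (fromℤ k)))) p<)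
      , *-monoˡ-<-pos 1/N {{1/pos⇒pos (fromℤ (+ suc n))}}
          (subst (_< 1ℚ + fromℤ k) (+-identityˡ (fromℤ k)) (+-monoˡ-< (fromℤ k) (positive⁻¹ 1ℚ)))
      where
      1/N : ℚ
      1/N = 1/ fromℤ (+ suc n)

  module _ (p : ℕ) where

    private
      P N : ℕ
      P = suc p
      N = 3 ℕ.* P

    gridSum : List ℕ → ℕ → ℚ
    gridSum []      k = 0ℚ
    gridSum (a ∷ A) k = cellValue P ((a ℕ.* k) ℕ.% N) + gridSum A k

    opaque
      -- Replacing the cell index by a representative modulo N amounts to translating x by the
      -- integer t, and this changes the floor of a x by a t.
      fSum-cell : ∀ {A x k j t} → All (λ a → 0 ℕ.< a × a ∣ P) A → Cell N x k → k ≡ + j ℤ.+ t ℤ.* + N →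
                  fSum A x (gridSum A j)
      fSum-cell [] cell eq = ≡-refl
      fSum-cell {a@(suc a′) ∷ A} {x} {k} {j} {t} ((_ , divides e P≡ea) ∷ all) cell eq =
        _ , _ , f-cell {e = e} P≡ea {x} {k} {+ (a ℕ.* j ℕ./ N) ℤ.+ + a ℤ.* t} cell residue (ℕ.m%n<n (a ℕ.* j) N)
        , fSum-cell {t = t} all cell eq , ≡-refl
        where
        open ≡-Reasoning
        r : ℕ
        r = (a ℕ.* j) ℕ.% N
        lem₁ : ∀ a j t n → a ℤ.* (j ℤ.+ t ℤ.* n) ≡ a ℤ.* j ℤ.+ a ℤ.* t ℤ.* n
        lem₁ = ℤ-Ring.solve-∀
        lem₂ : ∀ r q s n → r ℤ.+ q ℤ.* n ℤ.+ s ℤ.* n ≡ r ℤ.+ (q ℤ.+ s) ℤ.* n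
        lem₂ = ℤ-Ring.solve-∀
        residue : + a ℤ.* k ≡ + r ℤ.+ (+ (a ℕ.* j ℕ./ N) ℤ.+ + a ℤ.* t) ℤ.* + N
        residue = begin
          + a ℤ.* k                                                    ≡⟨ cong (λ z → + a ℤ.* z) eq ⟩
          + a ℤ.* (+ j ℤ.+ t ℤ.* + N)                                  ≡⟨ lem₁ (+ a) (+ j) t (+ N) ⟩
          + a ℤ.* + j ℤ.+ + a ℤ.* t ℤ.* + N
            ≡⟨ cong (λ z → z ℤ.+ + a ℤ.* t ℤ.* + N) (ℤ.pos-* a j) ⟨
          + (a ℕ.* j) ℤ.+ + a ℤ.* t ℤ.* + N
            ≡⟨ cong (λ z → + z ℤ.+ + a ℤ.* t ℤ.* + N) (ℕ.m≡m%n+[m/n]*n (a ℕ.* j) N) ⟩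
          + r ℤ.+ + (a ℕ.* j ℕ./ N ℕ.* N) ℤ.+ + a ℤ.* t ℤ.* + N
            ≡⟨ cong (λ z → + r ℤ.+ z ℤ.+ + a ℤ.* t ℤ.* + N) (ℤ.pos-* (a ℕ.* j ℕ./ N) N) ⟩
          + r ℤ.+ + (a ℕ.* j ℕ./ N) ℤ.* + N ℤ.+ + a ℤ.* t ℤ.* + N
            ≡⟨ lem₂ (+ r) (+ (a ℕ.* j ℕ./ N)) (+ a ℤ.* t) (+ N) ⟩
          + r ℤ.+ (+ (a ℕ.* j ℕ./ N) ℤ.+ + a ℤ.* t) ℤ.* + N            ∎

    opaque
      grid-maximum : ∀ {A} → All (λ a → 0 ℕ.< a × a ∣ P) A → ∃[ m ] IsMaximum (fSum A) m
      grid-maximum {A} all with argmax N (gridSum A)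
      ... | k , max = gridSum A k
          , (point (ℕ.pred N) (+ k) , fSum-cell {t = 0ℤ} all (point-cell (ℕ.pred N) (+ k)) (sym (ℤ.+-identityʳ (+ k))))
          -- The cell of x is the floor of N x, which exists only under a double negation; it is
          -- read off from the witness of `f-total`. The comparison with the grid maximum is between
          -- rationals, so the double negation can be removed.
          , λ x y S → decidable-stable (y ≤? gridSum A k) λ y≰ →
              f-total (N · x) λ (_ , i , cell , _) →
                y≰ (subst (_≤ gridSum A k) (fSum-unique A x (fSum-cell {t = i /ℕ N} all cell (a≡a%ℕn+[a/ℕn]*n i N)) S)
                  (max (i %ℕ N) (ℕ.<⇒≤ (n%ℕd<d i N))))

open import Data.List.Relation.Binary.BagAndSetEquality using (_∼[_]_; set; bag-=⇒; ↭⇒∼bag)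
open import Data.List.Relation.Binary.Permutation.Propositional using (_↭_; refl; prep; swap; ↭-sym; ↭-trans; ↭⇒↭ₛ)
open import Data.List.Relation.Binary.Permutation.Propositional.Properties using (All-resp-↭; ↭-length)
import Data.List.Relation.Binary.Permutation.Setoid.Properties as ↭ₛ
open import Data.List.Relation.Unary.All as All using (All; []; _∷_)
open import Data.List.Membership.Propositional using (_∈_)
open import Data.List.Relation.Unary.Any using (here; there)
open import Data.List.Relation.Unary.AllPairs using ([]; _∷_)
open import Data.List.Relation.Unary.Linked using (Linked; []; [-]; _∷_)
open import Data.List.Relation.Unary.Unique.Propositional using (Unique)
open import Data.List.Sort using (sort-↗; sort-↭)
open import Data.Integer as ℤ using (ℤ; +_; 0ℤ)
open import Data.Integer.DivMod using (_/ℕ_; _%ℕ_; a≡a%ℕn+[a/ℕn]*n; n%ℕd<d)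
import Data.Integer.Properties as ℤ
import Data.Integer.Tactic.RingSolver as ℤ-Ring
open import Data.Nat
open import Data.Nat.Divisibility
open import Data.Nat.GCD using (gcd; gcd-greatest)
open import Data.Nat.ListAction using (product)
open import Data.Nat.ListAction.Properties using (product≢0; ∈⇒∣product)
open import Data.Nat.Properties
open import Data.Nat.Tactic.RingSolver
open import Data.Product using (∃-syntax; _×_; _,_; proj₁; proj₂)
open import Data.Rational as ℚ using (ℚ; 0ℚ; 1ℚ) renaming (_<_ to _<ℚ_)
import Data.Rational.Properties as ℚ
open import Data.Sum using (_⊎_; inj₁; inj₂)
open import Relation.Binary.PropositionalEquality hiding ([_])
open import Relation.Nullary using (yes; no)
open import Relation.Nullary.Decidable using (from-yes)
open Arithmetic
open Cells

-- From a good triple to a large value of f_A.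

opaque
  cellValue-inside : ∀ {P m} → P ≤ m → m < 2 * P → cellValue P m ≡ 1ℚ ℚ.- ⅓
  cellValue-inside {P} {m} lo hi with inside? P m
  ... | yes _ = refl
  ... | no ¬in = ⊥-elim (¬in (lo , hi))

  cellValue-≥ : ∀ P m → 0ℚ ℚ.- ⅓ ℚ.≤ cellValue P m
  cellValue-≥ P m with inside? P m
  ... | yes _ = from-yes (0ℚ ℚ.- ⅓ ℚ.≤? 1ℚ ℚ.- ⅓)
  ... | no  _ = ℚ.≤-refl

module _ {p n π : ℕ} (P≡nπ : suc p ≡ n * π) (0<π : 0 < π) {x : ℝ} (j : ℤ)
         (cell : Cell (3 * suc p) x (j ℤ.* + (3 * π))) where

  private
    P N : ℕ
    P = suc p
    N = 3 * P

  opaque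
    -- The point j/n is the left end of the cell with index 3πj. Multiplication by 3π carries
    -- residues modulo n to residues modulo 3P, and the bound n/3 to P.
    middle-cell : ∀ {a} → 0 < a → a ∣ P → Middle n (j ℤ.* + a) → f (a · x) (1ℚ ℚ.- ⅓)
    middle-cell {a@(suc _)} 0<a (divides e P≡ea) (m , mod-by q eq , lo , hi) =
      subst (f (a · x)) (cellValue-inside P≤ <2P)
        (f-cell {e = e} P≡ea {x} {j ℤ.* + (3 * π)} {q} cell residue
          (<-≤-trans <2P (*-monoˡ-≤ P {2} {3} (s≤s (s≤s z≤n)))))
      where
      P≤ : P ≤ 3 * π * m
      P≤ = subst₂ _≤_ (sym (trans P≡nπ (*-comm n π))) (lem π m) (*-monoʳ-≤ π lo)
        where
        lem : ∀ π m → π * (3 * m) ≡ 3 * π * m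
        lem = solve-∀

      <2P : 3 * π * m < 2 * P
      <2P = subst₂ _<_ (l₁ π m) (trans (l₂ π n) (cong (2 *_) (sym P≡nπ))) (*-monoʳ-< π {{>-nonZero 0<π}} hi)
        where
        l₁ : ∀ π m → π * (3 * m) ≡ 3 * π * m
        l₁ = solve-∀
        l₂ : ∀ π n → π * (2 * n) ≡ 2 * (n * π)
        l₂ = solve-∀

      residue : + a ℤ.* (j ℤ.* + (3 * π)) ≡ + (3 * π * m) ℤ.+ q ℤ.* + N
      residue = begin
        + a ℤ.* (j ℤ.* + (3 * π))                                ≡⟨ l₁ (+ a) j (+ (3 * π)) ⟩
        + (3 * π) ℤ.* (j ℤ.* + a)                                ≡⟨ cong (λ z → + (3 * π) ℤ.* z) eq ⟩
        + (3 * π) ℤ.* (+ m ℤ.+ q ℤ.* + n)                        ≡⟨ l₂ (+ (3 * π)) (+ m) q (+ n) ⟩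
        + (3 * π) ℤ.* + m ℤ.+ q ℤ.* (+ (3 * π) ℤ.* + n)
          ≡⟨ cong₂ (λ y z → y ℤ.+ q ℤ.* z) (ℤ.pos-* (3 * π) m) (ℤ.pos-* (3 * π) n) ⟨
        + (3 * π * m) ℤ.+ q ℤ.* + (3 * π * n)
          ≡⟨ cong (λ z → + (3 * π * m) ℤ.+ q ℤ.* + z) (trans (l₃ π n) (cong (3 *_) (sym P≡nπ))) ⟩
        + (3 * π * m) ℤ.+ q ℤ.* + N                              ∎
        where
        open ≡-Reasoning
        l₁ : ∀ a j t → a ℤ.* (j ℤ.* t) ≡ t ℤ.* (j ℤ.* a)
        l₁ = ℤ-Ring.solve-∀
        l₂ : ∀ t m q n → t ℤ.* (m ℤ.+ q ℤ.* n) ≡ t ℤ.* m ℤ.+ q ℤ.* (t ℤ.* n)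
        l₂ = ℤ-Ring.solve-∀
        l₃ : ∀ π n → 3 * π * n ≡ 3 * (n * π)
        l₃ = solve-∀

    f-≥ : ∀ {a} → 0 < a → a ∣ P → ∃[ y ] f (a · x) y × 0ℚ ℚ.- ⅓ ℚ.≤ y
    f-≥ {a@(suc _)} 0<a (divides e P≡ea) =
      _ , f-cell {e = e} P≡ea {x} {k} {(+ a ℤ.* k) /ℕ N} cell (a≡a%ℕn+[a/ℕn]*n (+ a ℤ.* k) N) (n%ℕd<d (+ a ℤ.* k) N)
        , cellValue-≥ P ((+ a ℤ.* k) %ℕ N)
      where
      k : ℤ
      k = j ℤ.* + (3 * π)

opaque
  positive-predecessor : ∀ {n} → 0 < n → ∃[ p ] suc p ≡ n
  positive-predecessor {suc p} _ = p , refl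

  product-positive : ∀ {A} → All (0 <_) A → 0 < product A
  product-positive all = >-nonZero⁻¹ _ {{product≢0 (All.map >-nonZero all)}}

  maximum : ∀ {A} → All (0 <_) A → ∃[ m ] IsMaximum (fSum A) m
  maximum {A} all with positive-predecessor (product-positive all)
  ... | p , eq = grid-maximum p (All.tabulate λ a∈A → All.lookup all a∈A , subst (_ ∣_) (sym eq) (∈⇒∣product a∈A))

opaque
  -- P is n times the product of the elements: the factor n makes j/n a grid point, and the product
  -- makes every element a divisor of P.
  good⇒value : ∀ {a b c d} → All (0 <_) (a ∷ b ∷ c ∷ d ∷ []) → Good a b c →
               ∃[ x ] ∃[ y ] fSum (a ∷ b ∷ c ∷ d ∷ []) x y × ⅔ <ℚ y
  good⇒value {a} {b} {c} {d} all@(0<a ∷ 0<b ∷ 0<c ∷ 0<d ∷ []) (n , j , 0<n , A , B , C)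
    with positive-predecessor (*-mono-< 0<n (product-positive all))
  ... | p , P≡ = x , _
      , (_ , _ , mid 0<a (divs (here refl)) A
        , (_ , _ , mid 0<b (divs (there (here refl))) B
          , (_ , _ , mid 0<c (divs (there (there (here refl)))) C
            , (_ , _ , proj₁ (proj₂ last) , refl , refl) , refl) , refl) , refl)
      -- Three values 2/3 and a fourth of at least -1/3 add up to at least 5/3.
      , ℚ.<-≤-trans (from-yes (⅔ ℚ.<? t ℚ.+ (t ℚ.+ (t ℚ.+ ((0ℚ ℚ.- ⅓) ℚ.+ 0ℚ)))))
          (ℚ.+-monoʳ-≤ t (ℚ.+-monoʳ-≤ t (ℚ.+-monoʳ-≤ t (ℚ.+-monoˡ-≤ 0ℚ (proj₂ (proj₂ last))))))
    where
    π : ℕ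
    π = product (a ∷ b ∷ c ∷ d ∷ [])

    0<π : 0 < π
    0<π = product-positive all

    t : ℚ
    t = 1ℚ ℚ.- ⅓

    x : ℝ
    x = point (pred (3 * suc p)) (j ℤ.* + (3 * π))

    cell : Cell (3 * suc p) x (j ℤ.* + (3 * π))
    cell = point-cell (pred (3 * suc p)) (j ℤ.* + (3 * π))

    divs : ∀ {e} → e ∈ a ∷ b ∷ c ∷ d ∷ [] → e ∣ suc p
    divs {e} e∈ = subst (e ∣_) (sym P≡) (∣n⇒∣m*n n (∈⇒∣product e∈))

    mid : ∀ {e} → 0 < e → e ∣ suc p → Middle n (j ℤ.* + e) → f (e · x) t
    mid = middle-cell {n = n} {π} P≡ 0<π {x} j cell

    last : ∃[ y ] f (d · x) y × 0ℚ ℚ.- ⅓ ℚ.≤ y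
    last = f-≥ {n = n} {π} P≡ 0<π {x} j cell 0<d (divs (there (there (there (here refl)))))

Large : List ℕ → Set₁
Large A = ∃[ m ] IsMaximum (fSum A) m × ⅔ <ℚ m

opaque
  good⇒large : ∀ {A a b c d} → All (0 <_) A → (a ∷ b ∷ c ∷ d ∷ []) ↭ A → Good a b c → Large A
  good⇒large pos perm good
    with maximum pos | good⇒value (All-resp-↭ (↭-sym perm) pos) good
  ... | m , max | x , y , S , ⅔<y = m , max , ℚ.<-≤-trans ⅔<y (proj₂ max x y (fSum-↭ perm S))

opaque
  -- `good⇒large` takes the good triple from the first three entries, so each of the four triples is
  -- brought to the front by a permutation.
  ordered-quadruple : ∀ {A a b c d} → All (0 <_) A → (a ∷ b ∷ c ∷ d ∷ []) ↭ A → a < b → b < c → c < d →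
                      Large A ⊎ Quadruple a b c d
  ordered-quadruple {a = a} {b} {c} {d} pos perm a<b b<c c<d with All-resp-↭ (↭-sym perm) pos
  ... | 0<a ∷ 0<b ∷ _ with triple 0<a a<b b<c
  ...   | inj₁ good = inj₁ (good⇒large pos perm good)
  ...   | inj₂ D₁ with triple 0<a a<b (<-trans b<c c<d)
  ...     | inj₁ good = inj₁ (good⇒large pos (↭-trans (prep a (prep b (swap d c refl))) perm) good)
  ...     | inj₂ D₂ with triple 0<a (<-trans a<b b<c) c<d
  ...       | inj₁ good = inj₁ (good⇒large pos
                (↭-trans (prep a (↭-trans (prep c (swap d b refl)) (swap c b refl))) perm) good)
  ...       | inj₂ D₃ with triple 0<b b<c c<d
  ...         | inj₁ good = inj₁ (good⇒large pos
                  (↭-trans (prep b (prep c (swap d a refl)))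
                    (↭-trans (prep b (swap c a refl)) (↭-trans (swap b a refl) perm))) good)
  ...         | inj₂ D₄ = inj₂ (quadruple 0<a a<b b<c c<d D₁ D₂ D₃ D₄)

-- Coprimality, sorting and the exceptional sets.

opaque
  ∣-foldr-gcd : ∀ {t A} → All (t ∣_) A → t ∣ foldr gcd 0 A
  ∣-foldr-gcd []        = _ ∣0
  ∣-foldr-gcd (t∣a ∷ all) = gcd-greatest t∣a (∣-foldr-gcd all)

  ↭⇒∼set : ∀ {A B : List ℕ} → B ↭ A → A ∼[ set ] B
  ↭⇒∼set perm = bag-=⇒ (↭⇒∼bag (↭-sym perm))

opaque
  -- Fixes the unit of a sporadic ratio: the unit divides all four elements, hence is 1.
  coprime-divisor : ∀ {A B} → B ↭ A → foldr gcd 0 A ≡ 1 → ∀ t → All (t ∣_) B → t ≡ 1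
  coprime-divisor {A} perm gcd≡1 t all = ∣1⇒≡1 (subst (t ∣_) gcd≡1 (∣-foldr-gcd (All-resp-↭ perm all)))

opaque
  strict : ∀ {a b c d} → a ≤ b → b ≤ c → c ≤ d → Unique (a ∷ b ∷ c ∷ d ∷ []) → a < b × b < c × c < d
  strict a≤b b≤c c≤d ((a≢b ∷ _) ∷ (b≢c ∷ _) ∷ (c≢d ∷ _) ∷ _) = ≤∧≢⇒< a≤b a≢b , ≤∧≢⇒< b≤c b≢c , ≤∧≢⇒< c≤d c≢d

Exceptional : List ℕ → Set
Exceptional A =
  (∃[ u ] ∃[ v ] 0 < u × 0 < v × A ∼[ set ] (u ∷ 2 * u ∷ v ∷ 2 * v ∷ []))
  ⊎ (A ∼[ set ] (1 ∷ 2 ∷ 3 ∷ 4 ∷ [])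
  ⊎ A ∼[ set ] (1 ∷ 2 ∷ 4 ∷ 5 ∷ [])
  ⊎ A ∼[ set ] (1 ∷ 4 ∷ 5 ∷ 8 ∷ [])
  ⊎ A ∼[ set ] (2 ∷ 3 ∷ 5 ∷ 10 ∷ []))

opaque
  -- The unit is t = b - a: from 2b = 3a it follows that 2t = a, which yields the other multiples.
  unit-2-3-5-10 : ∀ {a b c d} → a < b → 2 * b ≡ 3 * a → 2 * c ≡ 5 * a → d ≡ 5 * a →
                  ∃[ t ] a ≡ 2 * t × b ≡ 3 * t × c ≡ 5 * t × d ≡ 10 * t
  unit-2-3-5-10 {a} {b} {c} a<b 2b≡3a 2c≡5a d≡5a with m≤n⇒∃[o]m+o≡n (<⇒≤ a<b)
  ... | t , a+t≡b = t , a≡2t , trans (sym a+t≡b) (trans (cong (_+ t) a≡2t) (lem 2 t))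
      , *-cancelˡ-≡ c (5 * t) 2 (trans 2c≡5a (trans (cong (5 *_) a≡2t) (exch t)))
      , trans d≡5a (trans (cong (5 *_) a≡2t) (sym (*-assoc 5 2 t)))
    where
    lem : ∀ k t → k * t + t ≡ suc k * t
    lem = solve-∀

    exch : ∀ t → 5 * (2 * t) ≡ 2 * (5 * t)
    exch = solve-∀

    triple-a : ∀ a → 3 * a ≡ 2 * a + a
    triple-a = solve-∀

    a≡2t : a ≡ 2 * t
    a≡2t = sym (+-cancelˡ-≡ (2 * a) (2 * t) a (begin
      2 * a + 2 * t   ≡⟨ *-distribˡ-+ 2 a t ⟨
      2 * (a + t)     ≡⟨ cong (2 *_) a+t≡b ⟩
      2 * b           ≡⟨ 2b≡3a ⟩
      3 * a           ≡⟨ triple-a a ⟩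
      2 * a + a       ∎))
      where open ≡-Reasoning

opaque
  exceptional : ∀ {A a b c d} → All (0 <_) A → (a ∷ b ∷ c ∷ d ∷ []) ↭ A → a < b → foldr gcd 0 A ≡ 1 →
                Quadruple a b c d → Exceptional A
  exceptional {a = a} {b} {c} pos perm a<b cop (pairs-12-34 refl refl) with All-resp-↭ (↭-sym perm) pos
  ... | 0<a ∷ _ ∷ 0<c ∷ _ = inj₁ (a , c , 0<a , 0<c , ↭⇒∼set perm)
  exceptional {a = a} {b} pos perm a<b cop (pairs-13-24 refl refl) with All-resp-↭ (↭-sym perm) pos
  ... | 0<a ∷ 0<b ∷ _ = inj₁ (a , b , 0<a , 0<b , ↭⇒∼set (↭-trans (prep a (swap (2 * a) b refl)) perm))
  exceptional {a = a} pos perm a<b cop (ratio-1-2-3-4 refl refl refl)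
    with coprime-divisor perm cop a (∣-refl ∷ n∣m*n 2 ∷ n∣m*n 3 ∷ n∣m*n 4 ∷ [])
  ... | refl = inj₂ (inj₁ (↭⇒∼set perm))
  exceptional {a = a} pos perm a<b cop (ratio-1-2-4-5 refl refl refl)
    with coprime-divisor perm cop a (∣-refl ∷ n∣m*n 2 ∷ n∣m*n 4 ∷ n∣m*n 5 ∷ [])
  ... | refl = inj₂ (inj₂ (inj₁ (↭⇒∼set perm)))
  exceptional {a = a} pos perm a<b cop (ratio-1-4-5-8 refl refl refl)
    with coprime-divisor perm cop a (∣-refl ∷ n∣m*n 4 ∷ n∣m*n 5 ∷ n∣m*n 8 ∷ [])
  ... | refl = inj₂ (inj₂ (inj₂ (inj₁ (↭⇒∼set perm))))
  exceptional {a = a} {b} {c} {d} pos perm a<b cop (ratio-2-3-5-10 2b≡3a 2c≡5a d≡5a)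
    with unit-2-3-5-10 {a} {b} {c} {d} a<b 2b≡3a 2c≡5a d≡5a
  ... | t , refl , refl , refl , refl with coprime-divisor perm cop t (n∣m*n 2 ∷ n∣m*n 3 ∷ n∣m*n 5 ∷ n∣m*n 10 ∷ [])
  ... | refl = inj₂ (inj₂ (inj₂ (inj₂ (↭⇒∼set perm))))

opaque
  sorted-quadruple : ∀ {A B} → Unique A → All (0 <_) A → length A ≡ 4 → foldr gcd 0 A ≡ 1 →
                     B ↭ A → Linked _≤_ B → Large A ⊎ Exceptional A
  sorted-quadruple {B = a ∷ b ∷ c ∷ d ∷ []} unique pos len cop perm (a≤b ∷ b≤c ∷ c≤d ∷ [-])
    with strict a≤b b≤c c≤d (↭ₛ.AllPairs-resp-↭ (setoid ℕ) ≢-sym (resp₂ _≢_) (↭⇒↭ₛ (↭-sym perm)) unique)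
  ... | a<b , b<c , c<d with ordered-quadruple pos perm a<b b<c c<d
  ...   | inj₁ large = inj₁ large
  ...   | inj₂ q     = inj₂ (exceptional pos perm a<b cop q)
  sorted-quadruple {B = []} _ _ len _ perm _ = ⊥-elim (0≢1+n (trans (↭-length perm) len))
  sorted-quadruple {B = _ ∷ []} _ _ len _ perm _ with () ← trans (↭-length perm) len
  sorted-quadruple {B = _ ∷ _ ∷ []} _ _ len _ perm _ with () ← trans (↭-length perm) len
  sorted-quadruple {B = _ ∷ _ ∷ _ ∷ []} _ _ len _ perm _ with () ← trans (↭-length perm) len
  sorted-quadruple {B = _ ∷ _ ∷ _ ∷ _ ∷ _ ∷ _} _ _ len _ perm _ with () ← trans (↭-length perm) len

theorem4 : (A : List ℕ) → Unique A → All (0 <_) A → length A ≡ 4 → foldr gcd 0 A ≡ 1 →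
    (∃[ m ] IsMaximum (fSum A) m × ⅔ <ℚ m)
    ⊎ (∃[ u ] ∃[ v ] 0 < u × 0 < v × A ∼[ set ] (u ∷ 2 * u ∷ v ∷ 2 * v ∷ []))
    ⊎ (A ∼[ set ] (1 ∷ 2 ∷ 3 ∷ 4 ∷ [])
    ⊎ A ∼[ set ] (1 ∷ 2 ∷ 4 ∷ 5 ∷ [])
    ⊎ A ∼[ set ] (1 ∷ 4 ∷ 5 ∷ 8 ∷ [])
    ⊎ A ∼[ set ] (2 ∷ 3 ∷ 5 ∷ 10 ∷ []))
theorem4 A unique pos len cop =
  sorted-quadruple unique pos len cop (sort-↭ ≤-decTotalOrder A) (sort-↗ ≤-decTotalOrder A)
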